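{- The edge generating series of the Dyck lattices is $$\sum_{n\ge0}\ell(\mathcal{D}_n)x^n=\frac{1-3x-(1-x)\sqrt{1-4x}}{2x\sqrt{1-4x}}.$$ Moreover, for every $n\ge2$, $$\ell(\mathcal{D}_n)=\frac12\binom{2n}{n}\frac{n-1}{n+1}=\binom{2n-1}{n-2},$$ and for every $n\ge1$ the Hasse index is $i(\mathcal{D}_n)=(n-1)/2$; in particular $i(\mathcal{D}_n)\sim n/2$.
   Context: Steps: $U=(1,1)$, $D=(1,-1)$. $\mathcal{D}_n$ is the set of Dyck paths of semi-length $n$ (lattice paths from $(0,0)$ to $(2n,0)$ with steps $U,D$ never going below the $x$-axis), partially ordered by $\gamma_1\le\gamma_2$ iff $\gamma_1$ lies weakly below $\gamma_2$. For a finite poset $P$, $\ell(P)$ is the number of edges of its Hasse diagram (i.e. the number of covering pairs), and the Hasse index is $i(P)=\ell(P)/|P|$. $a_n\sim b_n$ means $a_n/b_n\to1$. -}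

module Defs where

open import Data.Fin.Base as Fin using (Fin; zero; suc; fromℕ; toℕ)
import Data.Fin.Properties as Fin
open import Data.Integer.Base as ℤ using (ℤ; +_; 0ℤ; 1ℤ; -1ℤ)
import Data.Integer.Properties as ℤ
open import Algebra.Properties.AbelianGroup ℤ.+-0-abelianGroup using () renaming (∙-cancelˡ to +-cancelˡ)
open import Algebra.Properties.Semiring.Sum ℤ.+-*-semiring using (sum)
open import Data.List.Base as List using (List; []; _∷_; length; filter; cartesianProduct; cartesianProductWith)
open import Data.List.Membership.Propositional using (_∈_)
open import Data.List.Membership.Propositional.Properties using (∈-cartesianProductWith⁺)
import Data.List.Membership.Setoid as Membership
open import Data.List.Relation.Unary.All as All using (All; []; _∷_)
open import Data.List.Relation.Unary.AllPairs.Core using ([]; _∷_)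
open import Data.List.Relation.Unary.Any as Any using (Any; here; there; any?)
import Data.List.Relation.Unary.Enumerates.Setoid as Enumerates
import Data.List.Relation.Unary.Unique.Setoid as UniqueSetoid
open import Data.List.Relation.Unary.Unique.Propositional using (Unique)
import Data.List.Relation.Unary.Unique.Propositional.Properties as Unique
open import Data.Nat.Base as ℕ using (ℕ; zero; suc; z≤n; _∸_)
open import Data.Product.Base using (Σ; Σ-syntax; ∃-syntax; _×_; _,_; proj₁; proj₂)
open import Data.Rational.Base as ℚ using (ℚ; 0ℚ; 1ℚ)
open import Data.Vec.Base as Vec using (Vec; []; _∷_)
import Data.Vec.Properties as Vec
open import Function.Base using (_∘_; _on_)
open import Level using (Level; 0ℓ; _⊔_) renaming (suc to lsuc)
open import Relation.Binary.Bundles using (DecPoset)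
open import Relation.Binary.Definitions using (DecidableEquality)
open import Relation.Binary.PropositionalEquality.Core using (_≡_; refl; sym; trans; cong; subst)
open import Relation.Nullary.Decidable using (Dec; yes; no; map′; ¬?; _×-dec_)
open import Relation.Nullary.Negation using (¬_; contradiction)
import Relation.Unary as Unary

import Relation.Binary.Properties.Poset as PosetProperties

------------------------------------------------------------------------
-- Finite posets

record FinitePoset (a b c : Level) : Set (lsuc (a ⊔ b ⊔ c)) where
  field
    decPoset : DecPoset a b c

  open DecPoset decPoset public

  field
    elements : List Carrier
    complete : Enumerates.IsEnumeration Eq.setoid elements
    distinct : UniqueSetoid.Unique Eq.setoid elements

  open PosetProperties poset public using (_<_; <-resp-≈)

  _<?_ : ∀ x y → Dec (x < y)
  x <? y = (x ≤? y) ×-dec ¬? (x ≟ y)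

  infix 4 _⋖_ _⋖?_

  _⋖_ : Carrier → Carrier → Set (a ⊔ b ⊔ c)
  x ⋖ y = x < y × ¬ (∃[ z ] (x < z × z < y))

  _⋖?_ : ∀ x y → Dec (x ⋖ y)
  x ⋖? y = (x <? y) ×-dec ¬? (map′ fwd bwd (any? (λ z → (x <? z) ×-dec (z <? y)) elements))
    where
    open Membership Eq.setoid using (find; lose)

    fwd : Any (λ z → x < z × z < y) elements → ∃[ z ] (x < z × z < y)
    fwd p with find p
    ... | z , _ , q = z , q

    bwd : ∃[ z ] (x < z × z < y) → Any (λ z → x < z × z < y) elements
    bwd (z , q) = lose (λ u≈v (x<u , u<y) → proj₁ <-resp-≈ u≈v x<u , proj₂ <-resp-≈ u≈v u<y)
                       (complete z) q

module _ {a b c : Level} (P : FinitePoset a b c) where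
  open FinitePoset P

  -- Neither number depends on the chosen enumeration, since it lists
  -- every element exactly once.
  ∣_∣ : ℕ
  ∣_∣ = length elements

  ℓ : ℕ
  ℓ = length (filter (λ (x , y) → x ⋖? y) (cartesianProduct elements elements))

  hasseIndex : .{{_ : ℕ.NonZero ∣_∣}} → ℚ
  hasseIndex = + ℓ ℚ./ ∣_∣

------------------------------------------------------------------------
-- Dyck paths

data Step : Set where
  U D : Step

rise : Step → ℤ
rise U = 1ℤ
rise D = -1ℤ

-- height w k is the ordinate, at abscissa k, of the path from the origin
-- with steps w.
height : ∀ {m} → Vec Step m → Fin (suc m) → ℤ
height w       zero    = 0ℤ
height (s ∷ w) (suc k) = rise s ℤ.+ height w k

IsDyck : ∀ {m} → Vec Step m → Set
IsDyck {m} w = (∀ k → 0ℤ ℤ.≤ height w k) × height w (fromℕ m) ≡ 0ℤ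

DyckPath : ℕ → Set
DyckPath n = Σ[ w ∈ Vec Step (n ℕ.* 2) ] IsDyck w

infix 4 _≈ᴰ_ _≤ᴰ_

_≈ᴰ_ : ∀ {n} → DyckPath n → DyckPath n → Set
_≈ᴰ_ = _≡_ on proj₁

-- All paths are affine between consecutive integer abscissae, so lying
-- weakly below only has to be tested at those.
_≤ᴰ_ : ∀ {n} → DyckPath n → DyckPath n → Set
(v , _) ≤ᴰ (w , _) = ∀ k → height v k ℤ.≤ height w k

_≟ˢ_ : DecidableEquality Step
U ≟ˢ U = yes refl
U ≟ˢ D = no λ ()
D ≟ˢ U = no λ ()
D ≟ˢ D = yes refl

isDyck? : ∀ {m} → Unary.Decidable (IsDyck {m})
isDyck? {m} w =
  Fin.all? (λ k → 0ℤ ℤ.≤? height w k) ×-dec (height w (fromℕ m) ℤ.≟ 0ℤ)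

height-injective : ∀ {m} (v w : Vec Step m) → (∀ k → height v k ≡ height w k) → v ≡ w
height-injective []      []      _  = refl
height-injective (U ∷ v) (U ∷ w) eq =
  cong (U ∷_) (height-injective v w (λ k → +-cancelˡ 1ℤ _ _ (eq (suc k))))
height-injective (U ∷ v) (D ∷ w) eq = contradiction (eq (suc zero)) λ ()
height-injective (D ∷ v) (U ∷ w) eq = contradiction (eq (suc zero)) λ ()
height-injective (D ∷ v) (D ∷ w) eq =
  cong (D ∷_) (height-injective v w (λ k → +-cancelˡ -1ℤ _ _ (eq (suc k))))

dyckDecPoset : ℕ → DecPoset 0ℓ 0ℓ 0ℓ
dyckDecPoset n = record
  { Carrier           = DyckPath n
  ; _≈_               = _≈ᴰ_ {n}
  ; _≤_               = _≤ᴰ_ {n}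
  ; isDecPartialOrder = record
    { isPartialOrder = record
      { isPreorder = record
        { isEquivalence = record { refl = refl ; sym = sym ; trans = trans }
        ; reflexive     = λ { refl k → ℤ.≤-refl }
        ; trans         = λ p q k → ℤ.≤-trans (p k) (q k)
        }
      ; antisym = λ {γ} {δ} p q →
          height-injective (proj₁ γ) (proj₁ δ) (λ k → ℤ.≤-antisym (p k) (q k))
      }
    ; _≟_  = λ γ δ → Vec.≡-dec _≟ˢ_ (proj₁ γ) (proj₁ δ)
    ; _≤?_ = λ γ δ → Fin.all? (λ k → height (proj₁ γ) k ℤ.≤? height (proj₁ δ) k)
    }
  }

words : ∀ m → List (Vec Step m)
words zero    = [] ∷ []
words (suc m) = cartesianProductWith _∷_ (U ∷ D ∷ []) (words m)

words-complete : ∀ {m} (w : Vec Step m) → w ∈ words m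
words-complete []      = here refl
words-complete (U ∷ w) = ∈-cartesianProductWith⁺ _∷_ {xs = U ∷ D ∷ []} (here refl) (words-complete w)
words-complete (D ∷ w) = ∈-cartesianProductWith⁺ _∷_ {xs = U ∷ D ∷ []} (there (here refl)) (words-complete w)

words-distinct : ∀ m → Unique (words m)
words-distinct zero    = [] ∷ []
words-distinct (suc m) = Unique.cartesianProductWith⁺ _∷_ Vec.∷-injective
  (((λ ()) ∷ []) ∷ [] ∷ []) (words-distinct m)

module _ {A : Set} {P : A → Set} (P? : Unary.Decidable P) where

  select : List A → List (Σ A P)
  select []       = []
  select (x ∷ xs) with P? x
  ... | yes p = (x , p) ∷ select xs
  ... | no  _ = select xs

  select-complete : ∀ {xs} (y : Σ A P) → proj₁ y ∈ xs → Any ((_≡_ on proj₁) y) (select xs)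
  select-complete {x ∷ _} (y , q) (here y≡x) with P? x
  ... | yes _ = here y≡x
  ... | no ¬p = contradiction (subst P y≡x q) ¬p
  select-complete {x ∷ _} y (there y∈xs) with P? x
  ... | yes _ = there (select-complete y y∈xs)
  ... | no  _ = select-complete y y∈xs

  select-all : ∀ {Q : A → Set} {xs} → All Q xs → All (Q ∘ proj₁) (select xs)
  select-all []                 = []
  select-all {xs = x ∷ _} (q ∷ qs) with P? x
  ... | yes _ = q ∷ select-all qs
  ... | no  _ = select-all qs

𝓓 : ℕ → FinitePoset 0ℓ 0ℓ 0ℓ
𝓓 n = record
  { decPoset = dyckDecPoset n
  ; elements = select isDyck? (words (n ℕ.* 2))
  ; complete = λ γ → select-complete isDyck? γ (words-complete (proj₁ γ))
  ; distinct = distinct′ (words-distinct (n ℕ.* 2))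
  }
  where
  open DecPoset (dyckDecPoset n) using (module Eq)

  distinct′ : ∀ {ws} → Unique ws → UniqueSetoid.Unique Eq.setoid (select isDyck? ws)
  distinct′ []                = []
  distinct′ {w ∷ _} (w∉ ∷ ws!) with isDyck? w
  ... | yes _ = select-all isDyck? w∉ ∷ distinct′ ws!
  ... | no  _ = distinct′ ws!

zigzag : ∀ n → Vec Step (n ℕ.* 2)
zigzag zero    = []
zigzag (suc n) = U ∷ D ∷ zigzag n

zigzag-isDyck : ∀ n → IsDyck (zigzag n)
zigzag-isDyck n = nonNegative n , closed n
  where
  1-1+ : ∀ h → 1ℤ ℤ.+ (-1ℤ ℤ.+ h) ≡ h
  1-1+ h = trans (sym (ℤ.+-assoc 1ℤ -1ℤ h)) (ℤ.+-identityˡ h)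

  nonNegative : ∀ n k → 0ℤ ℤ.≤ height (zigzag n) k
  nonNegative n       zero          = ℤ.≤-refl
  nonNegative (suc n) (suc zero)    = ℤ.+≤+ z≤n
  nonNegative (suc n) (suc (suc k)) = subst (0ℤ ℤ.≤_) (sym (1-1+ _)) (nonNegative n k)

  closed : ∀ n → height (zigzag n) (fromℕ (n ℕ.* 2)) ≡ 0ℤ
  closed zero    = refl
  closed (suc n) = trans (1-1+ _) (closed n)

𝓓-nonEmpty : ∀ n → ℕ.NonZero ∣ 𝓓 n ∣
𝓓-nonEmpty n = nonEmpty (FinitePoset.complete (𝓓 n) (zigzag n , zigzag-isDyck n))
  where
  nonEmpty : ∀ {A : Set} {P : A → Set} {xs : List A} → Any P xs → ℕ.NonZero (length xs)
  nonEmpty (here _)  = _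
  nonEmpty (there _) = _

------------------------------------------------------------------------
-- Formal power series ℤ[[x]]

Series : Set
Series = ℕ → ℤ

infix  4 _≈ˢ_
infixl 6 _-ˢ_
infixl 7 _*ˢ_

_≈ˢ_ : Series → Series → Set
f ≈ˢ g = ∀ n → f n ≡ g n

const : ℤ → Series
const c zero    = c
const c (suc _) = 0ℤ

𝕩 : Series
𝕩 1 = 1ℤ
𝕩 _ = 0ℤ

_-ˢ_ : Series → Series → Series
(f -ˢ g) n = f n ℤ.- g n

_*ˢ_ : Series → Series → Series
(f *ˢ g) n = sum {suc n} (λ i → f (toℕ i) ℤ.* g (n ∸ toℕ i))

-- The branch of the square root with constant term 1. It is unique: ℤ[[x]]
-- is an integral domain and - s has constant term - 1.
_IsSqrtOf_ : Series → Series → Set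
s IsSqrtOf f = s 0 ≡ 1ℤ × s *ˢ s ≈ˢ f

-- h = f / g in the field of fractions of the integral domain ℤ[[x]]; the
-- denominator need not be invertible as a power series.
IsQuotient : (h f g : Series) → Set
IsQuotient h f g = ¬ (g ≈ˢ const 0ℤ) × h *ˢ g ≈ˢ f

edgeSeries : Series
edgeSeries n = + ℓ (𝓓 n)

------------------------------------------------------------------------
-- Asymptotic equivalence

-- a n / b n → 1, the quotient being defined for all large n. Since the
-- terms and the limit are rational, rational ε suffice.
_∼_ : (ℕ → ℚ) → (ℕ → ℚ) → Set
a ∼ b = ∀ ε → 0ℚ ℚ.< ε → ∃[ N ] ∀ n → N ℕ.≤ n →
  Σ[ b≢0 ∈ ℚ.NonZero (b n) ] ℚ.∣ (a n ℚ.÷ b n) {{b≢0}} ℚ.- 1ℚ ∣ ℚ.< ε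

{-# OPTIONS --safe #-}
-- A covering in 𝓓 n turns one valley DU of the lower path into a peak UD.
-- Removing the valley leaves a path of length 2n - 2 with a marked vertex off
-- the axis. There are 2n - 1 vertices in each of the Cat (n - 1) such paths,
-- and lifting the part before the mark shows that the marks on the axis
-- number Cat n, so ℓ (𝓓 n) + Cat n = (2n - 1) Cat (n - 1). With
-- (n + 1) Cat n = 2 (2n - 1) Cat (n - 1) this gives 2 ℓ (𝓓 n) = (n - 1) Cat n.
-- The same two recurrences express the edge series through s = √(1 - 4x) and
-- x s′, and s is handled via its equation (1 - 4x) s′ = - 2 s.
module Submission where

open import Defs
import Algebra.Properties.Semiring.Sum
open import Data.Fin.Base using (Fin; zero; suc; fromℕ; toℕ)
import Data.Fin.Permutation as Permutation
import Data.Fin.Properties as Fin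
open import Data.Integer.Base as ℤ using (ℤ; +_; +[1+_]; 0ℤ; 1ℤ; -1ℤ)
import Data.Integer.Properties as ℤ
import Data.Integer.Tactic.RingSolver as ℤ-Ring
open import Data.List.Base using (List; []; _∷_; _++_; length; map; filter; cartesianProduct)
open import Data.List.Membership.Propositional using (_∈_; find)
open import Data.List.Membership.Propositional.Properties
  using (∈-map⁺; ∈-map⁻; ∈-++⁺ˡ; ∈-++⁺ʳ; ∈-++⁻; ∈-filter⁺; ∈-filter⁻; ∈-cartesianProduct⁺)
open import Data.List.Membership.Propositional.Properties.WithK using (unique∧set⇒bag)
open import Data.List.Properties using (length-map; length-++)
open import Data.List.Relation.Binary.BagAndSetEquality using (∼bag⇒↭)
open import Data.List.Relation.Binary.Disjoint.Propositional using (Disjoint)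
open import Data.List.Relation.Binary.Permutation.Propositional.Properties using (↭-length)
open import Data.List.Relation.Unary.All as All using (All; [])
import Data.List.Relation.Unary.All.Properties as All
import Data.List.Relation.Unary.AllPairs as AllPairs
open import Data.List.Relation.Unary.AllPairs.Core using (AllPairs; []; _∷_)
import Data.List.Relation.Unary.AllPairs.Properties as AllPairs
open import Data.List.Relation.Unary.Any using (here)
open import Data.List.Relation.Unary.Unique.Propositional using (Unique)
import Data.List.Relation.Unary.Unique.Propositional.Properties as Unique
import Data.List.Relation.Unary.Unique.Setoid.Properties as UniqueSetoid
open import Data.Nat.Base as ℕ using (ℕ; zero; suc; _≤_; _<_; _∸_; _+_; _*_; z≤n; s≤s; NonZero)
open import Data.Nat.Combinatorics
  using (_C_; nCk≡nC[n∸k]; nCn≡1; nC1≡n; nCk+nC[k+1]≡[n+1]C[k+1]; k>n⇒nCk≡0)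
import Data.Nat.Properties as ℕ
open import Algebra.Properties.CommutativeSemigroup ℕ.*-commutativeSemigroup using (x∙yz≈y∙xz)
import Data.Nat.Tactic.RingSolver as ℕ-Ring
open import Data.Product.Base using (∃-syntax; _×_; _,_; proj₁; proj₂)
open import Data.Product.Relation.Binary.Pointwise.NonDependent using (_×ₛ_)
open import Data.Rational.Base as ℚ using (mkℚ; 1ℚ; _/_; ½; toℚᵘ)
import Data.Rational.Properties as ℚ
open import Data.Rational.Unnormalised.Base as ℚᵘ using (mkℚᵘ; *≡*; *<*)
import Data.Rational.Unnormalised.Properties as ℚᵘ
open import Data.Sum.Base using (_⊎_; inj₁; inj₂; [_,_]′)
open import Data.Vec.Base using (Vec; []; _∷_; head)
open import Data.Vec.Properties using (∷-injectiveʳ; ≡-dec)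
open import Function.Base using (_∘_; _on_)
open import Function.Bundles using (_⇔_; mk⇔; Equivalence)
import Relation.Binary.Construct.On as On
open import Relation.Binary.PropositionalEquality
  using (_≡_; _≢_; refl; setoid; sym; trans; cong; cong₂; subst; subst₂; module ≡-Reasoning)
open import Relation.Nullary.Decidable using (Dec; yes; no)
open import Relation.Nullary.Negation using (contradiction)

-- Removing the first step of a Dyck path does not leave a Dyck path. Paths, flips and counts are
-- therefore all taken from an arbitrary starting height `h` down to 0, and the identity of marks
-- becomes a statement in `m` and `h` that follows from the recurrences on the first step. Behind it
-- stands a bijection: raise the part before a mark on the axis by one and insert a `D` after it.
-- The inserted step is the first arrival on the axis, so the mark can be recovered; for `h = 0` a
-- leading `U` makes the result a Dyck path.
--
-- Read as a convolution of Catalan numbers, s² = 1 - 4x would call for the first-return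
-- decomposition. The differential equation avoids it: for p = s² the Leibniz rule gives (n + 1) p(n
-- + 1) = 4 (n - 1) p(n), and the factor n - 1 ends the series after its linear term.

private variable
  m n h d a b : ℕ
  v w z : Vec Step m

-- Paths, valley flips and the order, by induction on steps

-- `IsDyck` for any starting height. With the height in ℕ, no constructor can go below the axis, and
-- `[]` forces the end to lie on it.
data Ballot : ℕ → Vec Step m → Set where
  []   : Ballot 0 []
  up   : Ballot (suc h) w → Ballot h (U ∷ w)
  down : Ballot h w → Ballot (suc h) (D ∷ w)

infix 4 _↗_

data _↗_ : Vec Step m → Vec Step m → Set where
  here  : D ∷ U ∷ w ↗ U ∷ D ∷ w
  there : ∀ s → v ↗ w → s ∷ v ↗ s ∷ w

-- Below d v w: w, started 2d above the start of v, stays weakly above v and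
-- ends at the same point.
data Below : ℕ → Vec Step m → Vec Step m → Set where
  []    : Below 0 [] []
  same  : ∀ s → Below d v w → Below d (s ∷ v) (s ∷ w)
  widen : Below (suc d) v w → Below d (D ∷ v) (U ∷ w)
  close : Below d v w → Below (suc d) (U ∷ v) (D ∷ w)

Below-refl : (w : Vec Step m) → Below 0 w w
Below-refl []      = []
Below-refl (s ∷ w) = same s (Below-refl w)

Below-antisym : Below 0 v w → Below 0 w v → v ≡ w
Below-antisym []         []         = refl
Below-antisym (same s p) (same _ q) = cong (s ∷_) (Below-antisym p q)

↗⇒Below : v ↗ w → Below 0 v w
↗⇒Below here        = widen (close (Below-refl _))
↗⇒Below (there s p) = same s (↗⇒Below p)

↗⇒≢ : v ↗ w → v ≢ w
↗⇒≢ here        ()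
↗⇒≢ (there s p) eq = ↗⇒≢ p (∷-injectiveʳ eq)

↗-Ballot : v ↗ w → Ballot h v → Ballot h w
↗-Ballot here        (down (up p)) = up (down p)
↗-Ballot (there U p) (up q)        = up (↗-Ballot p q)
↗-Ballot (there D p) (down q)      = down (↗-Ballot p q)

-- Outside the flipped valley `z` is squeezed between equal paths. At the valley only one vertex is
-- free, and the first of the two steps decides it.
↗-nothingBetween : v ↗ w → Below 0 v z → Below 0 z w → z ≡ v ⊎ z ≡ w
↗-nothingBetween here (same _ (same _ p)) (widen (close q)) =
  inj₁ (cong (λ z → D ∷ U ∷ z) (Below-antisym q p))
↗-nothingBetween here (widen (close p)) (same _ (same _ q)) =
  inj₂ (cong (λ z → U ∷ D ∷ z) (Below-antisym q p))
↗-nothingBetween (there s v↗w) (same _ p) (same _ q) with ↗-nothingBetween v↗w p q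
... | inj₁ eq = inj₁ (cong (s ∷_) eq)
... | inj₂ eq = inj₂ (cong (s ∷_) eq)
↗-nothingBetween (there _ _) (widen _) ()

-- While v descends the gap to w cannot shrink, so the next valley of v can
-- be flipped without leaving the region below w.
flipNextValley : Below (suc d) v w →
                 ∃[ z ] D ∷ v ↗ z × Below d z (U ∷ w) × Below (suc d) z (D ∷ w)
-- The positive gap excludes `[]`, so `v` must rise again, and its first `U` forms a valley with the
-- step before it. The two bounds on `z` answer to the two steps that the upper path can take above
-- the leading `D`; the recursive calls use one or the other.
flipNextValley (same U p) = _ , here , same U (widen p) , close (widen p)
flipNextValley (close p)  = _ , here , same U (same D p) , close (same D p)
flipNextValley (same D p) with flipNextValley p
... | _ , v↗z , _ , q = _ , there D v↗z , widen q , same D q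
flipNextValley (widen p)  with flipNextValley p
... | _ , v↗z , q , _ = _ , there D v↗z , widen q , same D q

-- At gap 0 the paths can only part with `v` going down and `w` going up, which opens the gap that
-- `flipNextValley` asks for.
flipFirstValley : Below 0 v w → v ≢ w → ∃[ z ] v ↗ z × Below 0 z w
flipFirstValley []         v≢w = contradiction refl v≢w
flipFirstValley (same s p) v≢w with flipFirstValley p (v≢w ∘ cong (s ∷_))
... | _ , v↗z , q = _ , there s v↗z , same s q
flipFirstValley (widen p)  _   with flipNextValley p
... | _ , v↗z , q , _ = _ , v↗z , q

-- Heights of paths with an arbitrary starting height

ordinate : ℕ → Vec Step m → Fin (suc m) → ℤ
ordinate h w k = + h ℤ.+ height w k

ordinate-U : ∀ h (w : Vec Step m) k → ordinate h (U ∷ w) (suc k) ≡ ordinate (suc h) w k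
ordinate-U h w k = trans (sym (ℤ.+-assoc (+ h) 1ℤ (height w k)))
                         (cong (λ b → ordinate b w k) (ℕ.+-comm h 1))

ordinate-D : ∀ h (w : Vec Step m) k → ordinate (suc h) (D ∷ w) (suc k) ≡ ordinate h w k
ordinate-D h w k = sym (ℤ.+-assoc (+ suc h) -1ℤ (height w k))

Ballot⇒ordinate≥0 : {w : Vec Step m} → Ballot h w → ∀ k → 0ℤ ℤ.≤ ordinate h w k
Ballot⇒ordinate≥0 _        zero    = ℤ.+≤+ z≤n
Ballot⇒ordinate≥0 (up p)   (suc k) =
  subst (0ℤ ℤ.≤_) (sym (ordinate-U _ _ k)) (Ballot⇒ordinate≥0 p k)
Ballot⇒ordinate≥0 (down p) (suc k) =
  subst (0ℤ ℤ.≤_) (sym (ordinate-D _ _ k)) (Ballot⇒ordinate≥0 p k)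

Ballot⇒end≡0 : {w : Vec Step m} → Ballot h w → ordinate h w (fromℕ m) ≡ 0ℤ
Ballot⇒end≡0 []       = refl
Ballot⇒end≡0 (up {w = w} p)   = trans (ordinate-U _ w (fromℕ _)) (Ballot⇒end≡0 p)
Ballot⇒end≡0 (down {w = w} p) = trans (ordinate-D _ w (fromℕ _)) (Ballot⇒end≡0 p)

ordinate⇒Ballot : ∀ h (w : Vec Step m) → (∀ k → 0ℤ ℤ.≤ ordinate h w k) →
                  ordinate h w (fromℕ m) ≡ 0ℤ → Ballot h w
ordinate⇒Ballot zero    []      _ _ = []
ordinate⇒Ballot (suc _) []      _ ()
ordinate⇒Ballot h       (U ∷ w) p q =
  up (ordinate⇒Ballot (suc h) w (λ k → subst (0ℤ ℤ.≤_) (ordinate-U h w k) (p (suc k)))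
                                (trans (sym (ordinate-U h w (fromℕ _))) q))
ordinate⇒Ballot zero    (D ∷ w) p _ = contradiction (p (suc zero)) λ ()
ordinate⇒Ballot (suc h) (D ∷ w) p q =
  down (ordinate⇒Ballot h w (λ k → subst (0ℤ ℤ.≤_) (ordinate-D h w k) (p (suc k)))
                            (trans (sym (ordinate-D h w (fromℕ _))) q))

IsDyck⇔Ballot : (w : Vec Step m) → IsDyck w ⇔ Ballot 0 w
IsDyck⇔Ballot w = mk⇔
  (λ (p , q) → ordinate⇒Ballot 0 w
     (λ k → subst (0ℤ ℤ.≤_) (sym (ℤ.+-identityˡ (height w k))) (p k))
     (trans (ℤ.+-identityˡ (height w (fromℕ _))) q))
  (λ p → (λ k → subst (0ℤ ℤ.≤_) (ℤ.+-identityˡ (height w k)) (Ballot⇒ordinate≥0 p k))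
       , trans (sym (ℤ.+-identityˡ (height w (fromℕ _)))) (Ballot⇒end≡0 p))

private
  lift-D : ∀ {b} d a → b ≡ d * 2 + suc a → b ≡ suc (d * 2 + a)
  lift-D d a eq = trans eq (ℕ.+-suc (d * 2) a)

  lift-U : ∀ {b} d a → b ≡ suc (d * 2 + a) → b ≡ d * 2 + suc a
  lift-U d a eq = trans eq (sym (ℕ.+-suc (d * 2) a))

-- Paths with a common end differ in height by an even number at every abscissa. `d` is half of that
-- difference, so each step changes it by at most one and `b ≡ d * 2 + a` is the invariant of the
-- induction.
Below⇒ordinate≤ : {v w : Vec Step m} → ∀ d → b ≡ d * 2 + a → Ballot a v → Ballot b w → Below d v w →
                  ∀ k → ordinate a v k ℤ.≤ ordinate b w k
Below⇒ordinate≤ d eq _ _ _ zero =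
  ℤ.+≤+ (ℕ.+-monoˡ-≤ 0 (subst (_ ℕ.≤_) (sym eq) (ℕ.m≤n+m _ (d * 2))))
Below⇒ordinate≤ d eq (up p) (up q) (same U r) (suc k) =
  subst₂ ℤ._≤_ (sym (ordinate-U _ _ k)) (sym (ordinate-U _ _ k))
    (Below⇒ordinate≤ d (lift-U d _ (cong suc eq)) p q r k)
Below⇒ordinate≤ d eq (down p) (down q) (same D r) (suc k) =
  subst₂ ℤ._≤_ (sym (ordinate-D _ _ k)) (sym (ordinate-D _ _ k))
    (Below⇒ordinate≤ d (ℕ.suc-injective (lift-D d _ eq)) p q r k)
Below⇒ordinate≤ d eq (down p) (up q) (widen r) (suc k) =
  subst₂ ℤ._≤_ (sym (ordinate-D _ _ k)) (sym (ordinate-U _ _ k))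
    (Below⇒ordinate≤ (suc d) (cong suc (lift-D d _ eq)) p q r k)
Below⇒ordinate≤ (suc d) eq (up p) (down q) (close r) (suc k) =
  subst₂ ℤ._≤_ (sym (ordinate-U _ _ k)) (sym (ordinate-D _ _ k))
    (Below⇒ordinate≤ d (lift-U d _ (ℕ.suc-injective eq)) p q r k)

ordinate≤⇒Below : {v w : Vec Step m} → ∀ d → b ≡ d * 2 + a → Ballot a v → Ballot b w →
                  (∀ k → ordinate a v k ℤ.≤ ordinate b w k) → Below d v w
ordinate≤⇒Below zero _ [] [] _ = []
ordinate≤⇒Below d eq (up p) (up q) r =
  same U (ordinate≤⇒Below d (lift-U d _ (cong suc eq)) p q
    λ k → subst₂ ℤ._≤_ (ordinate-U _ _ k) (ordinate-U _ _ k) (r (suc k)))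
ordinate≤⇒Below d eq (down p) (down q) r =
  same D (ordinate≤⇒Below d (ℕ.suc-injective (lift-D d _ eq)) p q
    λ k → subst₂ ℤ._≤_ (ordinate-D _ _ k) (ordinate-D _ _ k) (r (suc k)))
ordinate≤⇒Below d eq (down p) (up q) r =
  widen (ordinate≤⇒Below (suc d) (cong suc (lift-D d _ eq)) p q
    λ k → subst₂ ℤ._≤_ (ordinate-D _ _ k) (ordinate-U _ _ k) (r (suc k)))
ordinate≤⇒Below (suc d) eq (up p) (down q) r =
  close (ordinate≤⇒Below d (lift-U d _ (ℕ.suc-injective eq)) p q
    λ k → subst₂ ℤ._≤_ (ordinate-U _ _ k) (ordinate-D _ _ k) (r (suc k)))
-- From a common height, `U` in `v` and `D` in `w` would put `v` two units above `w`.
ordinate≤⇒Below zero refl (up {w = v} p) (down {w = w} q) r =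
  contradiction
    (subst₂ ℤ._≤_ (ordinate-U _ v zero) (ordinate-D _ w zero) (r (suc zero)))
    (ℤ.<⇒≱ (ℤ.+<+ (ℕ.m<n⇒m<1+n (ℕ.n<1+n _))))

-- Coverings are flips of a valley

≤ᴰ⇔Below : ∀ n (γ δ : DyckPath n) → _≤ᴰ_ {n} γ δ ⇔ Below 0 (proj₁ γ) (proj₁ δ)
≤ᴰ⇔Below _ (v , p) (w , q) = mk⇔
  (λ r → ordinate≤⇒Below 0 refl p′ q′
     λ k → subst₂ ℤ._≤_ (sym (ℤ.+-identityˡ (height v k))) (sym (ℤ.+-identityˡ (height w k))) (r k))
  (λ r k → subst₂ ℤ._≤_ (ℤ.+-identityˡ (height v k)) (ℤ.+-identityˡ (height w k))
     (Below⇒ordinate≤ 0 refl p′ q′ r k))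
  where
  p′ = Equivalence.to (IsDyck⇔Ballot v) p
  q′ = Equivalence.to (IsDyck⇔Ballot w) q

-- If `δ` covers `γ`, the flip `z` found below `δ` lies strictly above `γ`, so it must be `δ`
-- itself. The converse is `↗-nothingBetween`.
⋖⇔↗ : ∀ n (γ δ : DyckPath n) → FinitePoset._⋖_ (𝓓 n) γ δ ⇔ proj₁ γ ↗ proj₁ δ
⋖⇔↗ n γ@(v , p) δ@(w , q) = mk⇔ to from
  where
  to : FinitePoset._⋖_ (𝓓 n) γ δ → v ↗ w
  to ((γ≤δ , v≢w) , ∄z) with flipFirstValley (Equivalence.to (≤ᴰ⇔Below n γ δ) γ≤δ) v≢w
  ... | z , v↗z , z≤w with ≡-dec _≟ˢ_ z w
  ... | yes refl = v↗z
  ... | no z≢w   = contradiction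
    ( ζ
    , (Equivalence.from (≤ᴰ⇔Below n γ ζ) (↗⇒Below v↗z) , ↗⇒≢ v↗z)
    , (Equivalence.from (≤ᴰ⇔Below n ζ δ) z≤w , z≢w)) ∄z
    where
    ζ : DyckPath n
    ζ = z , Equivalence.from (IsDyck⇔Ballot z) (↗-Ballot v↗z (Equivalence.to (IsDyck⇔Ballot v) p))

  from : v ↗ w → FinitePoset._⋖_ (𝓓 n) γ δ
  from v↗w = (Equivalence.from (≤ᴰ⇔Below n γ δ) (↗⇒Below v↗w) , ↗⇒≢ v↗w)
    , λ (ζ , (γ≤ζ , γ≢ζ) , ζ≤δ , ζ≢δ) →
      [ γ≢ζ ∘ sym , ζ≢δ ]′ (↗-nothingBetween v↗w (Equivalence.to (≤ᴰ⇔Below n γ ζ) γ≤ζ)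
                                                (Equivalence.to (≤ᴰ⇔Below n ζ δ) ζ≤δ))

-- Enumerations of paths and of coverings

descents : (m h : ℕ) → List (Vec Step (suc m))
paths    : (m h : ℕ) → List (Vec Step m)

descents m zero    = []
descents m (suc h) = map (D ∷_) (paths m h)

paths zero    zero    = [] ∷ []
paths zero    (suc _) = []
paths (suc m) h       = map (U ∷_) (paths m (suc h)) ++ descents m h

prefix : ∀ {m} → Step → Vec Step m × Vec Step m → Vec Step (suc m) × Vec Step (suc m)
prefix s (v , w) = s ∷ v , s ∷ w

flip : ∀ {m} → Vec Step m → Vec Step (2 + m) × Vec Step (2 + m)
flip w = D ∷ U ∷ w , U ∷ D ∷ w

-- The coverings whose valley comes first. `DU` returns to its starting height, so the rest is again
-- a path from `h`; a word of length 1 has no room for a valley.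
flips : (m h : ℕ) → List (Vec Step (suc m) × Vec Step (suc m))
flips zero    h = []
flips (suc m) h = map flip (paths m h)

coverings : (m h : ℕ) → List (Vec Step m × Vec Step m)
coverings zero    h       = []
coverings (suc m) zero    = map (prefix U) (coverings m 1)
coverings (suc m) (suc h) =
  map (prefix U) (coverings m (2 + h)) ++ map (prefix D) (coverings m h) ++ flips m (suc h)

∈-paths⁺ : Ballot h w → w ∈ paths m h
∈-paths⁺ []       = here refl
∈-paths⁺ (up p)   = ∈-++⁺ˡ (∈-map⁺ (U ∷_) (∈-paths⁺ p))
∈-paths⁺ (down p) = ∈-++⁺ʳ (map (U ∷_) _) (∈-map⁺ (D ∷_) (∈-paths⁺ p))

∈-paths⁻ : ∀ m h {w : Vec Step m} → w ∈ paths m h → Ballot h w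
∈-paths⁻ zero zero (here refl) = []
∈-paths⁻ (suc m) h w∈ with ∈-++⁻ (map (U ∷_) (paths m (suc h))) w∈
∈-paths⁻ (suc m) h       _ | inj₁ w∈ with _ , v∈ , refl ← ∈-map⁻ (U ∷_) w∈ = up (∈-paths⁻ m (suc h) v∈)
∈-paths⁻ (suc m) (suc h) _ | inj₂ w∈ with _ , v∈ , refl ← ∈-map⁻ (D ∷_) w∈ = down (∈-paths⁻ m h v∈)

∈-coverings⁺ : Ballot h v → v ↗ w → (v , w) ∈ coverings m h
∈-coverings⁺ {h = zero}  (up p) (there U v↗w) = ∈-map⁺ (prefix U) (∈-coverings⁺ p v↗w)
∈-coverings⁺ {h = suc _} (up p) (there U v↗w) = ∈-++⁺ˡ (∈-map⁺ (prefix U) (∈-coverings⁺ p v↗w))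
∈-coverings⁺ (down {h = h} p) (there D v↗w) =
  ∈-++⁺ʳ (map (prefix U) (coverings _ (2 + h))) (∈-++⁺ˡ (∈-map⁺ (prefix D) (∈-coverings⁺ p v↗w)))
∈-coverings⁺ (down {h = h} (up p)) here =
  ∈-++⁺ʳ (map (prefix U) (coverings _ (2 + h))) 
    (∈-++⁺ʳ (map (prefix D) (coverings _ h)) (∈-map⁺ flip (∈-paths⁺ p)))

∈-flips⁻ : ∀ m {v w : Vec Step (suc m)} → (v , w) ∈ flips m (suc h) → Ballot (suc h) v × v ↗ w
∈-flips⁻ (suc m) vw∈ with _ , w∈ , refl ← ∈-map⁻ flip vw∈ = down (up (∈-paths⁻ m _ w∈)) , here

∈-coverings⁻ : ∀ m h {v w : Vec Step m} → (v , w) ∈ coverings m h → Ballot h v × v ↗ w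
∈-coverings⁻ (suc m) zero vw∈ with _ , uv∈ , refl ← ∈-map⁻ (prefix U) vw∈
  with p , v↗w ← ∈-coverings⁻ m 1 uv∈ = up p , there U v↗w
∈-coverings⁻ (suc m) (suc h) vw∈ with ∈-++⁻ (map (prefix U) (coverings m (2 + h))) vw∈
... | inj₁ vw∈ with _ , uv∈ , refl ← ∈-map⁻ (prefix U) vw∈
  with p , v↗w ← ∈-coverings⁻ m (2 + h) uv∈ = up p , there U v↗w
... | inj₂ vw∈ with ∈-++⁻ (map (prefix D) (coverings m h)) vw∈
... | inj₁ vw∈ with _ , uv∈ , refl ← ∈-map⁻ (prefix D) vw∈
  with p , v↗w ← ∈-coverings⁻ m h uv∈ = down p , there D v↗w
... | inj₂ vw∈ = ∈-flips⁻ m vw∈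

separate : ∀ {A B : Set} (f : A → B) {a b xs ys} → a ≢ b →
           All (λ x → f x ≡ a) xs → All (λ y → f y ≡ b) ys → Disjoint xs ys
separate f a≢b p q (v∈xs , v∈ys) = a≢b (trans (sym (All.lookup p v∈xs)) (All.lookup q v∈ys))

map-constant : ∀ {A B C : Set} {f : A → B} {g : B → C} {c} →
               (∀ x → g (f x) ≡ c) → ∀ xs → All (λ y → g y ≡ c) (map f xs)
map-constant eq xs = All.map⁺ (All.universal eq xs)

paths-unique : ∀ m h → Unique (paths m h)
paths-unique zero    zero    = [] ∷ []
paths-unique zero    (suc _) = []
paths-unique (suc m) h       =
  Unique.++⁺ (Unique.map⁺ ∷-injectiveʳ (paths-unique m (suc h))) (descents-unique h)
    (separate head (λ ()) (map-constant (λ _ → refl) _) (descents-head h))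
  where
  descents-unique : ∀ h → Unique (descents m h)
  descents-unique zero    = []
  descents-unique (suc h) = Unique.map⁺ ∷-injectiveʳ (paths-unique m h)

  descents-head : ∀ h → All (λ w → head w ≡ D) (descents m h)
  descents-head zero    = []
  descents-head (suc h) = map-constant (λ _ → refl) (paths m h)

prefix-injective : ∀ s {p q : Vec Step m × Vec Step m} → prefix s p ≡ prefix s q → p ≡ q
prefix-injective s refl = refl

-- The first steps of the lower and the upper path tell the three pieces apart: they are `U` and
-- `U`, `D` and `D`, `D` and `U`.
coverings-unique : ∀ m h → Unique (coverings m h)
coverings-unique zero    h       = []
coverings-unique (suc m) zero    = Unique.map⁺ (prefix-injective U) (coverings-unique m 1)
coverings-unique (suc m) (suc h) =
  Unique.++⁺ (Unique.map⁺ (prefix-injective U) (coverings-unique m (2 + h)))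
    (Unique.++⁺ (Unique.map⁺ (prefix-injective D) (coverings-unique m h)) (flips-unique m)
      (separate (head ∘ proj₂) (λ ()) (map-constant (λ _ → refl) _) (flips-head₂ m)))
    (separate (head ∘ proj₁) (λ ()) (map-constant (λ _ → refl) _)
      (All.++⁺ (map-constant (λ _ → refl) (coverings m h)) (flips-head₁ m)))
  where
  flips-unique : ∀ m → Unique (flips m (suc h))
  flips-unique zero    = []
  flips-unique (suc m) = Unique.map⁺ (λ { refl → refl }) (paths-unique m (suc h))

  flips-head₁ : ∀ m → All (λ vw → head (proj₁ vw) ≡ D) (flips m (suc h))
  flips-head₁ zero    = []
  flips-head₁ (suc m) = map-constant (λ _ → refl) (paths m (suc h))

  flips-head₂ : ∀ m → All (λ vw → head (proj₂ vw) ≡ U) (flips m (suc h))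
  flips-head₂ zero    = []
  flips-head₂ (suc m) = map-constant (λ _ → refl) (paths m (suc h))

-- From the lattices to the enumerations

unique⇒length≡ : ∀ {A : Set} {xs ys : List A} → Unique xs → Unique ys →
                 (∀ {x} → x ∈ xs ⇔ x ∈ ys) → length xs ≡ length ys
unique⇒length≡ p q eq = ↭-length (∼bag⇒↭ (unique∧set⇒bag p q eq))

module _ {A B : Set} (f : A → B) {xs : List A} (distinct : AllPairs (_≢_ on f) xs) where

  -- An element of `𝓓 n` pairs a word with a proof and is compared by its word alone. With `f` the
  -- projection, the count passes to lists of bare words.
  length≡ : ∀ {ys} → Unique ys → (∀ {x} → x ∈ xs → f x ∈ ys) →
            (∀ {y} → y ∈ ys → ∃[ x ] x ∈ xs × y ≡ f x) → length xs ≡ length ys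
  length≡ ys! to from = trans (sym (length-map f xs))
    (unique⇒length≡ (AllPairs.map⁺ distinct) ys! (mk⇔
      (λ y∈ → let x , x∈ , eq = ∈-map⁻ f y∈ in subst (_∈ _) (sym eq) (to x∈))
      (λ y∈ → let x , x∈ , eq = from y∈ in subst (_∈ _) (sym eq) (∈-map⁺ f x∈))))

module _ {A B : Set} (f : A → B) {xs : List A} (distinct : AllPairs (_≢_ on f) xs)
         {R : A → A → Set} (R? : ∀ x y → Dec (R x y)) where

  private
    f₂ : A × A → B × B
    f₂ (x , y) = f x , f y

    R₂? = λ ((x , y) : A × A) → R? x y

    distinct₂ : AllPairs (_≢_ on f₂) (filter R₂? (cartesianProduct xs xs))
    distinct₂ = AllPairs.map (λ ≉ eq → ≉ (cong proj₁ eq , cong proj₂ eq))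
      (UniqueSetoid.filter⁺ (S ×ₛ S) R₂? (UniqueSetoid.cartesianProduct⁺ S S distinct distinct))
      where S = On.setoid (setoid B) f

  length-filter-cartesianProduct :
    ∀ {ys} → Unique ys →
    (∀ x y → R x y → (f x , f y) ∈ ys) →
    (∀ {b c} → (b , c) ∈ ys → ∃[ x ] ∃[ y ] x ∈ xs × y ∈ xs × R x y × b ≡ f x × c ≡ f y) →
    length (filter (λ (x , y) → R? x y) (cartesianProduct xs xs)) ≡ length ys
  length-filter-cartesianProduct ys! to from =
    length≡ f₂ distinct₂ ys! (λ xy∈ → to _ _ (proj₂ (∈-filter⁻ R₂? {xs = cartesianProduct xs xs} xy∈)))
      λ bc∈ → let x , y , x∈ , y∈ , r , eq₁ , eq₂ = from bc∈ in
        (x , y) , ∈-filter⁺ R₂? (∈-cartesianProduct⁺ x∈ y∈) r , cong₂ _,_ eq₁ eq₂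

module _ (n : ℕ) where
  open FinitePoset (𝓓 n) using (elements; complete; distinct; _⋖?_)

  ∣𝓓∣≡∣paths∣ : ∣ 𝓓 n ∣ ≡ length (paths (n * 2) 0)
  ∣𝓓∣≡∣paths∣ = length≡ proj₁ distinct (paths-unique (n * 2) 0)
    (λ {(w , p)} _ → ∈-paths⁺ (Equivalence.to (IsDyck⇔Ballot w) p))
    λ w∈ → find (complete (_ , Equivalence.from (IsDyck⇔Ballot _) (∈-paths⁻ (n * 2) 0 w∈)))

  ℓ𝓓≡∣coverings∣ : ℓ (𝓓 n) ≡ length (coverings (n * 2) 0)
  ℓ𝓓≡∣coverings∣ = length-filter-cartesianProduct proj₁ {elements} distinct _⋖?_
    (coverings-unique (n * 2) 0) to from
    where
    to : ∀ γ δ → FinitePoset._⋖_ (𝓓 n) γ δ → (proj₁ γ , proj₁ δ) ∈ coverings (n * 2) 0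
    to γ@(v , p) δ γ⋖δ =
      ∈-coverings⁺ (Equivalence.to (IsDyck⇔Ballot v) p) (Equivalence.to (⋖⇔↗ n γ δ) γ⋖δ)

    from : ∀ {v w} → (v , w) ∈ coverings (n * 2) 0 → ∃[ γ ] ∃[ δ ]
      γ ∈ elements × δ ∈ elements × FinitePoset._⋖_ (𝓓 n) γ δ × v ≡ proj₁ γ × w ≡ proj₁ δ
    from {v} {w} vw∈ with p , v↗w ← ∈-coverings⁻ (n * 2) 0 vw∈
      with find (complete (v , Equivalence.from (IsDyck⇔Ballot v) p))
         | find (complete (w , Equivalence.from (IsDyck⇔Ballot w) (↗-Ballot v↗w p)))
    ... | γ , γ∈ , refl | δ , δ∈ , refl =
      γ , δ , γ∈ , δ∈ , Equivalence.from (⋖⇔↗ n γ δ) v↗w , refl , refl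

-- Counting paths and coverings

abstract

  -- Abstract, so that from here on the counts are known only through their recurrences and the
  -- lists never unfold.
  #paths #coverings : ℕ → ℕ → ℕ
  #paths     m h = length (paths m h)
  #coverings m h = length (coverings m h)

  #paths-suc-zero : ∀ m → #paths (suc m) 0 ≡ #paths m 1
  #paths-suc-zero m = trans (length-++ (map (U ∷_) (paths m 1)))
    (trans (ℕ.+-identityʳ _) (length-map (U ∷_) (paths m 1)))

  #paths-suc-suc : ∀ m h → #paths (suc m) (suc h) ≡ #paths m (2 + h) + #paths m h
  #paths-suc-suc m h = trans (length-++ (map (U ∷_) (paths m (2 + h))))
    (cong₂ _+_ (length-map (U ∷_) (paths m (2 + h))) (length-map (D ∷_) (paths m h)))

  #coverings-suc-zero : ∀ m → #coverings (suc m) 0 ≡ #coverings m 1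
  #coverings-suc-zero m = length-map (prefix U) (coverings m 1)

  #coverings-suc-suc : ∀ m h → #coverings (2 + m) (suc h) ≡
    #coverings (suc m) (2 + h) + (#coverings (suc m) h + #paths m (suc h))
  #coverings-suc-suc m h = trans (length-++ (map (prefix U) (coverings (suc m) (2 + h))))
    (cong₂ _+_ (length-map (prefix U) (coverings (suc m) (2 + h)))
      (trans (length-++ (map (prefix D) (coverings (suc m) h)))
        (cong₂ _+_ (length-map (prefix D) (coverings (suc m) h)) (length-map flip (paths m (suc h))))))

  #paths-zero-zero : #paths 0 0 ≡ 1
  #paths-zero-zero = refl

  #paths-zero-suc : ∀ h → #paths 0 (suc h) ≡ 0
  #paths-zero-suc h = refl

  #coverings-zero : ∀ h → #coverings 0 h ≡ 0
  #coverings-zero h = refl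

  #coverings-two : ∀ h → #coverings 2 h + #paths 1 (suc h) ≡ #paths 0 h
  #coverings-two zero          = refl
  #coverings-two (suc zero)    = refl
  #coverings-two (suc (suc h)) = refl

  ∣𝓓∣≡#paths : ∀ n → ∣ 𝓓 n ∣ ≡ #paths (n * 2) 0
  ∣𝓓∣≡#paths = ∣𝓓∣≡∣paths∣

  ℓ𝓓≡#coverings : ∀ n → ℓ (𝓓 n) ≡ #coverings (n * 2) 0
  ℓ𝓓≡#coverings = ℓ𝓓≡∣coverings∣

-- A covering is a path of length m with one of its m + 1 vertices marked,
-- the valley being inserted there. The marked vertex may not be on the
-- axis, and the paths marked on the axis correspond to the paths from
-- height h + 1.
#coverings+#paths : ∀ m h → #coverings (2 + m) h + #paths (suc m) (suc h) ≡ suc m * #paths m h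
#coverings+#paths zero    h    = trans (#coverings-two h) (sym (ℕ.*-identityˡ _))
#coverings+#paths (suc m) zero = begin
  #coverings (3 + m) 0 + #paths (2 + m) 1
    ≡⟨ cong₂ _+_ (#coverings-suc-zero (2 + m)) (#paths-suc-suc (suc m) 0) ⟩
  #coverings (2 + m) 1 + (#paths (suc m) 2 + #paths (suc m) 0)
    ≡⟨ ℕ.+-assoc (#coverings (2 + m) 1) _ _ ⟨
  #coverings (2 + m) 1 + #paths (suc m) 2 + #paths (suc m) 0
    ≡⟨ cong₂ _+_ (#coverings+#paths m 1) (#paths-suc-zero m) ⟩
  suc m * #paths m 1 + #paths m 1
    ≡⟨ ℕ.+-comm (suc m * #paths m 1) _ ⟩
  (2 + m) * #paths m 1
    ≡⟨ cong ((2 + m) *_) (#paths-suc-zero m) ⟨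
  (2 + m) * #paths (suc m) 0 ∎
  where open ≡-Reasoning
#coverings+#paths (suc m) (suc h) = begin
  #coverings (3 + m) (suc h) + #paths (2 + m) (2 + h)
    ≡⟨ cong₂ _+_ (#coverings-suc-suc (suc m) h) (#paths-suc-suc (suc m) (suc h)) ⟩
  #coverings (2 + m) (2 + h) + (#coverings (2 + m) h + #paths (suc m) (suc h))
    + (#paths (suc m) (3 + h) + #paths (suc m) (suc h))
    -- Of the two copies of `#paths (suc m) (suc h)`, one completes the induction hypothesis at
    -- height `h`; the other counts the paths marked at their first vertex and raises the factor
    -- from `suc m` to `2 + m`.
    ≡⟨ regroup (#coverings (2 + m) (2 + h)) (#coverings (2 + m) h)
               (#paths (suc m) (suc h)) (#paths (suc m) (3 + h)) ⟩
  (#coverings (2 + m) (2 + h) + #paths (suc m) (3 + h))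
    + (#coverings (2 + m) h + #paths (suc m) (suc h)) + #paths (suc m) (suc h)
    ≡⟨ cong (_+ #paths (suc m) (suc h))
         (cong₂ _+_ (#coverings+#paths m (2 + h)) (#coverings+#paths m h)) ⟩
  suc m * #paths m (2 + h) + suc m * #paths m h + #paths (suc m) (suc h)
    ≡⟨ cong (_+ #paths (suc m) (suc h)) (ℕ.*-distribˡ-+ (suc m) (#paths m (2 + h)) _) ⟨
  suc m * (#paths m (2 + h) + #paths m h) + #paths (suc m) (suc h)
    ≡⟨ cong (λ p → suc m * p + #paths (suc m) (suc h)) (#paths-suc-suc m h) ⟨
  suc m * #paths (suc m) (suc h) + #paths (suc m) (suc h)
    ≡⟨ ℕ.+-comm (suc m * #paths (suc m) (suc h)) _ ⟩
  (2 + m) * #paths (suc m) (suc h) ∎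
  where
  open ≡-Reasoning

  regroup : ∀ a b c d → a + (b + c) + (d + c) ≡ (a + d) + (b + c) + c
  regroup = ℕ-Ring.solve-∀

-- Binomial coefficients

nC0≡1 : ∀ n → n C 0 ≡ 1
nC0≡1 n = trans (nCk≡nC[n∸k] {0} {n} z≤n) (nCn≡1 n)

C-absorption : ∀ n k → suc k * (suc n C suc k) ≡ suc n * (n C k)
C-absorption n       zero    = begin
  1 * (suc n C 1)  ≡⟨ ℕ.*-identityˡ _ ⟩
  suc n C 1        ≡⟨ nC1≡n (suc n) ⟩
  suc n            ≡⟨ ℕ.*-identityʳ (suc n) ⟨
  suc n * 1        ≡⟨ cong (suc n *_) (nC0≡1 n) ⟨
  suc n * (n C 0)  ∎
  where open ≡-Reasoning
C-absorption zero    (suc k) = begin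
  (2 + k) * (1 C (2 + k)) ≡⟨ cong ((2 + k) *_) (k>n⇒nCk≡0 {1} {2 + k} (s≤s (s≤s z≤n))) ⟩
  (2 + k) * 0             ≡⟨ ℕ.*-zeroʳ (2 + k) ⟩
  0                       ≡⟨ cong (1 *_) (k>n⇒nCk≡0 {0} {suc k} (s≤s z≤n)) ⟨
  1 * (0 C suc k)         ∎
  where open ≡-Reasoning
C-absorption (suc n) (suc k) = begin
  (2 + k) * ((2 + n) C (2 + k))
    ≡⟨ cong ((2 + k) *_) (nCk+nC[k+1]≡[n+1]C[k+1] (suc n) (suc k)) ⟨
  (2 + k) * (p + q)
    ≡⟨ expand k p q ⟩
  p + (suc k * p + (2 + k) * q)
    ≡⟨ cong (p ℕ.+_) (cong₂ _+_ (C-absorption n k) (C-absorption n (suc k))) ⟩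
  p + (suc n * (n C k) + suc n * (n C suc k))
    ≡⟨ cong (p ℕ.+_) (ℕ.*-distribˡ-+ (suc n) (n C k) _) ⟨
  p + suc n * (n C k + n C suc k)
    ≡⟨ cong (λ r → p + suc n * r) (nCk+nC[k+1]≡[n+1]C[k+1] n k) ⟩
  (2 + n) * p ∎
  where
  open ≡-Reasoning
  p = suc n C suc k
  q = suc n C (2 + k)

  expand : ∀ k p q → (2 + k) * (p + q) ≡ p + ((1 + k) * p + (2 + k) * q)
  expand = ℕ-Ring.solve-∀

-- Absorption, less `suc k` times the other summand in Pascal's rule. With the upper index written
-- `j + k`, the factor n - k is `j` and no truncated subtraction occurs.
C-ratio : ∀ j k → suc k * ((j + k) C suc k) ≡ j * ((j + k) C k)
C-ratio j k = ℕ.+-cancelˡ-≡ (suc k * p) _ _ (begin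
  suc k * p + suc k * ((j + k) C suc k)   ≡⟨ ℕ.*-distribˡ-+ (suc k) p _ ⟨
  suc k * (p + (j + k) C suc k)           ≡⟨ cong (suc k *_) (nCk+nC[k+1]≡[n+1]C[k+1] (j + k) k) ⟩
  suc k * (suc (j + k) C suc k)           ≡⟨ C-absorption (j + k) k ⟩
  suc (j + k) * p                         ≡⟨ split j k p ⟩
  suc k * p + j * p                       ∎)
  where
  open ≡-Reasoning
  p = (j + k) C k

  split : ∀ j k p → (1 + (j + k)) * p ≡ (1 + k) * p + j * p
  split = ℕ-Ring.solve-∀

C-symmetric : ∀ k → suc (k * 2) C suc k ≡ suc (k * 2) C k
C-symmetric k = trans (nCk≡nC[n∸k] (s≤s (ℕ.m≤m*n k 2)))
  (cong (suc (k * 2) C_) (trans (cong (_∸ k) double) (ℕ.m+n∸n≡m k k)))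
  where
  double : k * 2 ≡ k + k
  double = trans (ℕ.*-comm k 2) (cong (k ℕ.+_) (ℕ.+-identityʳ k))

C-central-half : ∀ k → (suc k * 2) C suc k ≡ 2 * (suc (k * 2) C k)
C-central-half k = begin
  (suc k * 2) C suc k                          ≡⟨ nCk+nC[k+1]≡[n+1]C[k+1] (suc (k * 2)) k ⟨
  suc (k * 2) C k + suc (k * 2) C suc k        ≡⟨ cong (p ℕ.+_) (trans (C-symmetric k) (sym (ℕ.+-identityʳ p))) ⟩
  2 * (suc (k * 2) C k)                        ∎
  where
  open ≡-Reasoning
  p = suc (k * 2) C k

-- The ballot numbers

#paths-above : ∀ m h → m < h → #paths m h ≡ 0
#paths-above zero    (suc h) _         = #paths-zero-suc h
#paths-above (suc m) (suc h) (s≤s m<h) = trans (#paths-suc-suc m h)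
  (cong₂ _+_ (#paths-above m (2 + h) (ℕ.m<n⇒m<1+n (ℕ.m<n⇒m<1+n m<h))) (#paths-above m h m<h))

#paths-diagonal : ∀ h → #paths h h ≡ 1
#paths-diagonal zero    = #paths-zero-zero
#paths-diagonal (suc h) = trans (#paths-suc-suc h h)
  (cong₂ _+_ (#paths-above h (2 + h) (ℕ.m<n⇒m<1+n (ℕ.n<1+n h))) (#paths-diagonal h))

-- The reflection principle without subtraction: `m C suc k` counts all words from height `h` to 0,
-- which have `suc k` up-steps, and those that dip below the axis reflect to words with `k`
-- up-steps. The induction needs only Pascal's rule.
#paths+C : ∀ m h k → m ≡ h + suc k * 2 → #paths m h + m C k ≡ m C suc k
#paths+C (suc m) zero zero refl =
  cong (_+ 1) (trans (#paths-suc-zero 1) (#paths-diagonal 1))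
#paths+C (suc m) zero (suc k) refl = begin
  #paths (suc m) 0 + suc m C suc k
    ≡⟨ cong₂ _+_ (#paths-suc-zero m) (sym (nCk+nC[k+1]≡[n+1]C[k+1] m k)) ⟩
  #paths m 1 + (m C k + m C suc k)
    ≡⟨ ℕ.+-assoc (#paths m 1) _ _ ⟨
  #paths m 1 + m C k + m C suc k
    -- On the axis there is no down-step to supply the second summand. Here `m` is 3 + 2k, and its
    -- two central coefficients agree.
    ≡⟨ cong₂ _+_ (#paths+C m 1 k refl) (sym (C-symmetric (suc k))) ⟩
  m C suc k + m C (2 + k)
    ≡⟨ nCk+nC[k+1]≡[n+1]C[k+1] m (suc k) ⟩
  suc m C (2 + k) ∎
  where open ≡-Reasoning
#paths+C (suc m) (suc h) zero eq = begin
  #paths (suc m) (suc h) + suc m C 0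
    ≡⟨ cong₂ _+_ (#paths-suc-suc m h) (trans (nC0≡1 (suc m)) (sym (nC0≡1 m))) ⟩
  #paths m (2 + h) + #paths m h + m C 0
    ≡⟨ ℕ.+-assoc (#paths m (2 + h)) _ _ ⟩
  #paths m (2 + h) + (#paths m h + m C 0)
    ≡⟨ cong₂ _+_ (trans (cong (λ m → #paths m (2 + h)) (trans m≡ (ℕ.+-comm h 2)))
                        (#paths-diagonal (2 + h)))
                 (#paths+C m h 0 m≡) ⟩
  1 + m C 1
    ≡⟨ cong (_+ m C 1) (nC0≡1 m) ⟨
  m C 0 + m C 1
    ≡⟨ nCk+nC[k+1]≡[n+1]C[k+1] m 0 ⟩
  suc m C 1 ∎
  where
  open ≡-Reasoning
  m≡ = ℕ.suc-injective eq
#paths+C (suc m) (suc h) (suc k) eq = begin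
  #paths (suc m) (suc h) + suc m C suc k
    ≡⟨ cong₂ _+_ (#paths-suc-suc m h) (sym (nCk+nC[k+1]≡[n+1]C[k+1] m k)) ⟩
  #paths m (2 + h) + #paths m h + (m C k + m C suc k)
    ≡⟨ interchange (#paths m (2 + h)) (#paths m h) (m C k) (m C suc k) ⟩
  (#paths m (2 + h) + m C k) + (#paths m h + m C suc k)
    ≡⟨ cong₂ _+_ (#paths+C m (2 + h) k (trans m≡ (shift h (suc k * 2)))) (#paths+C m h (suc k) m≡) ⟩
  m C suc k + m C (2 + k)
    ≡⟨ nCk+nC[k+1]≡[n+1]C[k+1] m (suc k) ⟩
  suc m C (2 + k) ∎
  where
  open ≡-Reasoning
  m≡ = ℕ.suc-injective eq

  shift : ∀ a b → a + (2 + b) ≡ 2 + a + b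
  shift = ℕ-Ring.solve-∀

  interchange : ∀ a b c d → a + b + (c + d) ≡ (a + c) + (b + d)
  interchange = ℕ-Ring.solve-∀

-- Catalan numbers and the number of coverings

catalan : ℕ → ℕ
catalan n = #paths (n * 2) 0

-- Reflection writes Cat n as the central coefficient minus its left neighbour, which by `C-ratio`
-- is n/(n + 1) of it.
catalan-closed : ∀ n → suc n * catalan n ≡ (n * 2) C n
catalan-closed zero    = trans (ℕ.*-identityˡ _) #paths-zero-zero
catalan-closed (suc k) = ℕ.+-cancelʳ-≡ ((2 + k) * (N C k)) _ _ (begin
  (2 + k) * catalan (suc k) + (2 + k) * (N C k)
    ≡⟨ ℕ.*-distribˡ-+ (2 + k) (catalan (suc k)) _ ⟨
  (2 + k) * (catalan (suc k) + N C k)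
    ≡⟨ cong ((2 + k) *_) (#paths+C N 0 k refl) ⟩
  N C suc k + suc k * (N C suc k)
    ≡⟨ cong (N C suc k ℕ.+_)
         (subst (λ m → suc k * (m C suc k) ≡ (2 + k) * (m C k)) (double k) (C-ratio (2 + k) k)) ⟩
  N C suc k + (2 + k) * (N C k) ∎)
  where
  open ≡-Reasoning
  N = suc k * 2

  double : ∀ k → 2 + k + k ≡ (1 + k) * 2
  double = ℕ-Ring.solve-∀

catalan-suc : ∀ n → (2 + n) * catalan (suc n) ≡ 2 * (suc (n * 2) * catalan n)
catalan-suc n = ℕ.*-cancelˡ-≡ _ _ (suc n) (begin
  suc n * ((2 + n) * catalan (suc n))      ≡⟨ cong (suc n *_) (trans (catalan-closed (suc n)) (C-central-half n)) ⟩
  suc n * (2 * (suc (n * 2) C n))          ≡⟨ cong (λ p → suc n * (2 * p)) (C-symmetric n) ⟨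
  suc n * (2 * (suc (n * 2) C suc n))      ≡⟨ x∙yz≈y∙xz (suc n) 2 (suc (n * 2) C suc n) ⟩
  2 * (suc n * (suc (n * 2) C suc n))      ≡⟨ cong (2 *_) (C-absorption (n * 2) n) ⟩
  2 * (suc (n * 2) * ((n * 2) C n))        ≡⟨ cong (λ p → 2 * (suc (n * 2) * p)) (catalan-closed n) ⟨
  2 * (suc (n * 2) * (suc n * catalan n))  ≡⟨ cong (2 *_) (x∙yz≈y∙xz (suc (n * 2)) (suc n) (catalan n)) ⟩
  2 * (suc n * (suc (n * 2) * catalan n))  ≡⟨ x∙yz≈y∙xz 2 (suc n) (suc (n * 2) * catalan n) ⟩
  suc n * (2 * (suc (n * 2) * catalan n))  ∎)
  where
  open ≡-Reasoning
edges : ℕ → ℕ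
edges n = #coverings (n * 2) 0

edges+catalan : ∀ n → edges (suc n) + catalan (suc n) ≡ suc (n * 2) * catalan n
edges+catalan n =
  trans (cong (edges (suc n) ℕ.+_) (#paths-suc-zero (suc (n * 2)))) (#coverings+#paths (n * 2) 0)

2*edges : ∀ n → 2 * edges (suc n) ≡ n * catalan (suc n)
2*edges n = ℕ.+-cancelʳ-≡ (2 * catalan (suc n)) _ _ (begin
  2 * edges (suc n) + 2 * catalan (suc n)  ≡⟨ ℕ.*-distribˡ-+ 2 (edges (suc n)) _ ⟨
  2 * (edges (suc n) + catalan (suc n))    ≡⟨ cong (2 *_) (edges+catalan n) ⟩
  2 * (suc (n * 2) * catalan n)            ≡⟨ catalan-suc n ⟨
  (2 + n) * catalan (suc n)                ≡⟨ cong (_* catalan (suc n)) (ℕ.+-comm 2 n) ⟩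
  (n + 2) * catalan (suc n)                ≡⟨ ℕ.*-distribʳ-+ (catalan (suc n)) n 2 ⟩
  n * catalan (suc n) + 2 * catalan (suc n) ∎)
  where open ≡-Reasoning

edges-closed : ∀ k → edges (2 + k) ≡ (3 + k * 2) C k
edges-closed k = ℕ.*-cancelˡ-≡ _ _ 2 (ℕ.*-cancelˡ-≡ _ _ (3 + k) (begin
  (3 + k) * (2 * edges (2 + k))
    ≡⟨ cong ((3 + k) *_) (2*edges (suc k)) ⟩
  (3 + k) * (suc k * catalan (2 + k))
    ≡⟨ x∙yz≈y∙xz (3 + k) (suc k) (catalan (2 + k)) ⟩
  suc k * ((3 + k) * catalan (2 + k))
    ≡⟨ cong (suc k *_) (trans (catalan-closed (2 + k)) (C-central-half (suc k))) ⟩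
  suc k * (2 * (N C suc k))
    ≡⟨ x∙yz≈y∙xz (suc k) 2 (N C suc k) ⟩
  2 * (suc k * (N C suc k))
    ≡⟨ cong (2 *_)
         (subst (λ m → suc k * (m C suc k) ≡ (3 + k) * (m C k)) (double k) (C-ratio (3 + k) k)) ⟩
  2 * ((3 + k) * (N C k))
    ≡⟨ x∙yz≈y∙xz 2 (3 + k) (N C k) ⟩
  (3 + k) * (2 * (N C k)) ∎))
  where
  open ≡-Reasoning
  N = 3 + k * 2

  double : ∀ k → 3 + k + k ≡ 3 + k * 2
  double = ℕ-Ring.solve-∀

-- Power series

private
  module Sum = Algebra.Properties.Semiring.Sum ℤ.+-*-semiring
  variable
    f g : Series

infixl 6 _+ˢ_
infixl 7 _·_

_+ˢ_ : Series → Series → Series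
(f +ˢ g) n = f n ℤ.+ g n

_·_ : ℤ → Series → Series
(c · f) n = c ℤ.* f n

-- x d/dx
θ : Series → Series
θ f n = + n ℤ.* f n

tail : Series → Series
tail f = f ∘ suc

*ˢ-congʳ : ∀ h → f ≈ˢ g → f *ˢ h ≈ˢ g *ˢ h
*ˢ-congʳ h f≈g n = Sum.sum-cong-≗ {suc n} (λ i → cong (ℤ._* h (n ∸ toℕ i)) (f≈g (toℕ i)))

*ˢ-comm : ∀ f g → f *ˢ g ≈ˢ g *ˢ f
*ˢ-comm f g n = trans
  (Sum.sum-permute (λ i → f (toℕ i) ℤ.* g (n ∸ toℕ i)) (Permutation.reverse {suc n}))
  (Sum.sum-cong-≗ {suc n} λ i → trans
    (cong (λ j → f j ℤ.* g (n ∸ j)) (Fin.opposite-prop i))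
    (trans (cong (λ j → f (n ∸ toℕ i) ℤ.* g j) (ℕ.m∸[m∸n]≡n (Fin.toℕ≤pred[n] i)))
           (ℤ.*-comm (f (n ∸ toℕ i)) (g (toℕ i)))))

*ˢ-distribʳ-+ˢ : ∀ h f g → (f +ˢ g) *ˢ h ≈ˢ f *ˢ h +ˢ g *ˢ h
*ˢ-distribʳ-+ˢ h f g n = trans
  (Sum.sum-cong-≗ {suc n} λ i → ℤ.*-distribʳ-+ (h (n ∸ toℕ i)) (f (toℕ i)) (g (toℕ i)))
  (Sum.∑-distrib-+ {suc n} (λ i → f (toℕ i) ℤ.* h (n ∸ toℕ i)) (λ i → g (toℕ i) ℤ.* h (n ∸ toℕ i)))

·-*ˢ : ∀ c f g → (c · f) *ˢ g ≈ˢ c · (f *ˢ g)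
·-*ˢ c f g n = sym (trans
  (Sum.*-distribˡ-sum {suc n} c (λ i → f (toℕ i) ℤ.* g (n ∸ toℕ i)))
  (Sum.sum-cong-≗ {suc n} λ i → sym (ℤ.*-assoc c (f (toℕ i)) (g (n ∸ toℕ i)))))

const-*ˢ : ∀ c f → const c *ˢ f ≈ˢ c · f
const-*ˢ c f n = trans (cong (ℤ._+_ (c ℤ.* f n)) (Sum.sum-replicate-zero n)) (ℤ.+-identityʳ _)

-- In each summand the factor n splits as j + (n - j). Unlike d/dx, `θ` shifts no index.
θ-*ˢ : ∀ f g → θ (f *ˢ g) ≈ˢ θ f *ˢ g +ˢ f *ˢ θ g
θ-*ˢ f g n = trans (Sum.*-distribˡ-sum {suc n} (+ n) (λ i → f (toℕ i) ℤ.* g (n ∸ toℕ i)))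
  (trans (Sum.sum-cong-≗ {suc n} λ i → leibniz (toℕ i) (Fin.toℕ≤pred[n] i))
         (Sum.∑-distrib-+ {suc n} (λ i → θ f (toℕ i) ℤ.* g (n ∸ toℕ i))
                                  (λ i → f (toℕ i) ℤ.* θ g (n ∸ toℕ i))))
  where
  expand : ∀ a b x y → (a ℤ.+ b) ℤ.* (x ℤ.* y) ≡ a ℤ.* x ℤ.* y ℤ.+ x ℤ.* (b ℤ.* y)
  expand = ℤ-Ring.solve-∀

  leibniz : ∀ j → j ℕ.≤ n → + n ℤ.* (f j ℤ.* g (n ∸ j)) ≡ θ f j ℤ.* g (n ∸ j) ℤ.+ f j ℤ.* θ g (n ∸ j)
  leibniz j j≤n = trans (cong (λ k → + k ℤ.* (f j ℤ.* g (n ∸ j))) (sym (ℕ.m+[n∸m]≡n j≤n)))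
                        (expand (+ j) (+ (n ∸ j)) (f j) (g (n ∸ j)))

𝕩-tail : tail 𝕩 ≈ˢ const 1ℤ
𝕩-tail zero    = refl
𝕩-tail (suc n) = refl

-- The square root of 1 - 4x

-- This is 1 - 2x C(x), with C the Catalan generating series, as solving C = 1 + x C² for C
-- suggests.
√1-4x : Series
√1-4x zero    = 1ℤ
√1-4x (suc n) = ℤ.- (+ 2) ℤ.* + catalan n

-- (1 - 4x) s′ = - 2 s, for s = √(1 - 4x)
√1-4x-ode : tail (θ √1-4x) ≈ˢ + 4 · θ √1-4x +ˢ (ℤ.- + 2) · √1-4x
√1-4x-ode zero    = cong (λ c → 1ℤ ℤ.* (ℤ.- (+ 2) ℤ.* + c)) #paths-zero-zero
√1-4x-ode (suc n) = trans (lhs (+ n) (+ catalan (suc n)))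
  (trans (cong (λ c → ℤ.- (+ 2) ℤ.* c) eq) (rhs (+ n) (+ catalan n)))
  where
  eq : (+ 2 ℤ.+ + n) ℤ.* + catalan (suc n) ≡ + 2 ℤ.* ((1ℤ ℤ.+ + n ℤ.* + 2) ℤ.* + catalan n)
  eq = trans (sym (ℤ.pos-* (2 + n) (catalan (suc n)))) (trans (cong +_ (catalan-suc n))
    (trans (ℤ.pos-* 2 (suc (n * 2) * catalan n)) (cong (ℤ._*_ (+ 2))
      (trans (ℤ.pos-* (suc (n * 2)) (catalan n))
        (cong (λ k → (1ℤ ℤ.+ k) ℤ.* + catalan n) (ℤ.pos-* n 2))))))

  lhs : ∀ n c → (+ 2 ℤ.+ n) ℤ.* (ℤ.- (+ 2) ℤ.* c) ≡ ℤ.- (+ 2) ℤ.* ((+ 2 ℤ.+ n) ℤ.* c)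
  lhs = ℤ-Ring.solve-∀

  rhs : ∀ n c → ℤ.- (+ 2) ℤ.* (+ 2 ℤ.* ((1ℤ ℤ.+ n ℤ.* + 2) ℤ.* c)) ≡
                + 4 ℤ.* ((1ℤ ℤ.+ n) ℤ.* (ℤ.- (+ 2) ℤ.* c)) ℤ.+ (ℤ.- + 2) ℤ.* (ℤ.- (+ 2) ℤ.* c)
  rhs = ℤ-Ring.solve-∀

2·θ√*√ : + 2 · (θ √1-4x *ˢ √1-4x) ≈ˢ θ (√1-4x *ˢ √1-4x)
2·θ√*√ n = sym (trans (θ-*ˢ √1-4x √1-4x n)
  (trans (cong (ℤ._+_ q) (*ˢ-comm √1-4x (θ √1-4x) n)) (double q)))
  where
  q = (θ √1-4x *ˢ √1-4x) n

  double : ∀ q → q ℤ.+ q ≡ + 2 ℤ.* q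
  double = ℤ-Ring.solve-∀

-- (1 - 4x) p′ = - 4 p, for p = s²
square-ode : ∀ n → let p = √1-4x *ˢ √1-4x in
             + suc n ℤ.* p (suc n) ≡ + 4 ℤ.* (+ n ℤ.- 1ℤ) ℤ.* p n
square-ode n = begin
  + suc n ℤ.* p (suc n)
    ≡⟨ 2·θ√*√ (suc n) ⟨
  + 2 ℤ.* (θ √1-4x *ˢ √1-4x) (suc n)
    -- `θ √1-4x` has constant term 0, so the convolution loses its first summand and the
    -- differential equation applies to the tail.
    ≡⟨ cong (ℤ._*_ (+ 2)) (ℤ.+-identityˡ _) ⟩
  + 2 ℤ.* (tail (θ √1-4x) *ˢ √1-4x) n
    ≡⟨ cong (ℤ._*_ (+ 2)) (trans (*ˢ-congʳ √1-4x √1-4x-ode n)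
         (trans (*ˢ-distribʳ-+ˢ √1-4x (+ 4 · θ √1-4x) ((ℤ.- + 2) · √1-4x) n)
           (cong₂ ℤ._+_ (·-*ˢ (+ 4) (θ √1-4x) √1-4x n) (·-*ˢ (ℤ.- + 2) √1-4x √1-4x n)))) ⟩
  + 2 ℤ.* (+ 4 ℤ.* q ℤ.+ ℤ.- + 2 ℤ.* p n)
    ≡⟨ regroup q (p n) ⟩
  + 4 ℤ.* (+ 2 ℤ.* q) ℤ.- + 4 ℤ.* p n
    ≡⟨ cong (λ r → + 4 ℤ.* r ℤ.- + 4 ℤ.* p n) (2·θ√*√ n) ⟩
  + 4 ℤ.* (+ n ℤ.* p n) ℤ.- + 4 ℤ.* p n
    ≡⟨ factor (+ n) (p n) ⟩
  + 4 ℤ.* (+ n ℤ.- 1ℤ) ℤ.* p n ∎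
  where
  open ≡-Reasoning
  p = √1-4x *ˢ √1-4x
  q = (θ √1-4x *ˢ √1-4x) n

  regroup : ∀ q p → + 2 ℤ.* (+ 4 ℤ.* q ℤ.+ ℤ.- + 2 ℤ.* p) ≡ + 4 ℤ.* (+ 2 ℤ.* q) ℤ.- + 4 ℤ.* p
  regroup = ℤ-Ring.solve-∀

  factor : ∀ n p → + 4 ℤ.* (n ℤ.* p) ℤ.- + 4 ℤ.* p ≡ + 4 ℤ.* (n ℤ.- 1ℤ) ℤ.* p
  factor = ℤ-Ring.solve-∀

square-one : (√1-4x *ˢ √1-4x) 1 ≡ ℤ.- + 4
square-one = trans (sym (ℤ.*-identityˡ _)) (square-ode 0)

-- The factor n - 1 of `square-ode` is 0 at n = 1, which kills the coefficient of x²; from there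
-- each coefficient inherits 0 from the one before.
square-≥2 : ∀ n → (√1-4x *ˢ √1-4x) (2 + n) ≡ 0ℤ
square-≥2 n = ℤ.*-cancelˡ-≡ (+ (2 + n)) _ 0ℤ
  (trans (square-ode (suc n)) (trans (vanish n) (sym (ℤ.*-zeroʳ (+ (2 + n))))))
  where
  vanish : ∀ n → + 4 ℤ.* (+ suc n ℤ.- 1ℤ) ℤ.* (√1-4x *ˢ √1-4x) (suc n) ≡ 0ℤ
  vanish zero    = refl
  vanish (suc n) = trans (cong (ℤ._*_ (+ 4 ℤ.* + suc n)) (square-≥2 n)) (ℤ.*-zeroʳ (+ 4 ℤ.* + suc n))

√1-4x-isSqrt : √1-4x IsSqrtOf (const (+ 1) -ˢ const (+ 4) *ˢ 𝕩)
√1-4x-isSqrt = refl , square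
  where
  square : √1-4x *ˢ √1-4x ≈ˢ const (+ 1) -ˢ const (+ 4) *ˢ 𝕩
  square 0             = refl
  square 1             = square-one
  square (suc (suc n)) = trans (square-≥2 n) (sym (cong (λ z → 0ℤ ℤ.- z) (const-*ˢ (+ 4) 𝕩 (2 + n))))

-- The edge series as a quotient

edgeSeries≡edges : ∀ n → edgeSeries n ≡ + edges n
edgeSeries≡edges n = cong +_ (ℓ𝓓≡#coverings n)

-- 2 E = - 2 x s′ + s + 1 + (s - 1) / x, where s = √(1 - 4x)
edgeSeries-via-√1-4x : + 2 · edgeSeries ≈ˢ
  (ℤ.- + 2) · θ √1-4x +ˢ √1-4x +ˢ const 1ℤ +ˢ tail √1-4x
-- The recurrence of the coverings starts at n = 1. At n = 0 the summand `const 1ℤ` balances 1 from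
-- s and -2 from its tail.
edgeSeries-via-√1-4x zero    = trans
  (cong (ℤ._*_ (+ 2)) (trans (edgeSeries≡edges 0) (cong +_ (#coverings-zero 0))))
  (sym (cong (λ c → + 2 ℤ.+ ℤ.- + 2 ℤ.* + c) #paths-zero-zero))
edgeSeries-via-√1-4x (suc n) = begin
  + 2 ℤ.* edgeSeries (suc n)
    ≡⟨ cong (ℤ._*_ (+ 2)) (edgeSeries≡edges (suc n)) ⟩
  + 2 ℤ.* + edges (suc n)
    ≡⟨ complete (+ edges (suc n)) (+ catalan (suc n)) ⟩
  + 2 ℤ.* (+ edges (suc n) ℤ.+ + catalan (suc n)) ℤ.- + 2 ℤ.* + catalan (suc n)
    ≡⟨ cong (λ k → + 2 ℤ.* k ℤ.- + 2 ℤ.* + catalan (suc n)) eq ⟩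
  + 2 ℤ.* ((1ℤ ℤ.+ + n ℤ.* + 2) ℤ.* + catalan n) ℤ.- + 2 ℤ.* + catalan (suc n)
    ≡⟨ regroup (+ n) (+ catalan n) (+ catalan (suc n)) ⟩
  ((ℤ.- + 2) · θ √1-4x +ˢ √1-4x +ˢ const 1ℤ +ˢ tail √1-4x) (suc n) ∎
  where
  open ≡-Reasoning
  complete : ∀ e c → + 2 ℤ.* e ≡ + 2 ℤ.* (e ℤ.+ c) ℤ.- + 2 ℤ.* c
  complete = ℤ-Ring.solve-∀

  eq : + edges (suc n) ℤ.+ + catalan (suc n) ≡ (1ℤ ℤ.+ + n ℤ.* + 2) ℤ.* + catalan n
  eq = trans (cong +_ (edges+catalan n)) (trans (ℤ.pos-* (suc (n * 2)) (catalan n))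
    (cong (λ k → (1ℤ ℤ.+ k) ℤ.* + catalan n) (ℤ.pos-* n 2)))

  regroup : ∀ n c c′ → + 2 ℤ.* ((1ℤ ℤ.+ n ℤ.* + 2) ℤ.* c) ℤ.- + 2 ℤ.* c′ ≡
    (ℤ.- + 2) ℤ.* ((1ℤ ℤ.+ n) ℤ.* (ℤ.- + 2 ℤ.* c)) ℤ.+ ℤ.- + 2 ℤ.* c ℤ.+ 0ℤ ℤ.+ ℤ.- + 2 ℤ.* c′
  regroup = ℤ-Ring.solve-∀

-- Multiplication by s turns 2 x s′ into x p′ and the tail of s into the tail of p minus that of s.
-- Apart from terms linear in s, only the known series p is left.
2·edgeSeries*√1-4x : ∀ n → let p = √1-4x *ˢ √1-4x in
  + 2 ℤ.* (edgeSeries *ˢ √1-4x) n ≡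
  p n ℤ.+ p (suc n) ℤ.- + n ℤ.* p n ℤ.+ √1-4x n ℤ.- √1-4x (suc n)
2·edgeSeries*√1-4x n = begin
  + 2 ℤ.* (edgeSeries *ˢ s) n
    ≡⟨ ·-*ˢ (+ 2) edgeSeries s n ⟨
  (+ 2 · edgeSeries *ˢ s) n
    ≡⟨ *ˢ-congʳ s edgeSeries-via-√1-4x n ⟩
  (((ℤ.- + 2) · θ s +ˢ s +ˢ const 1ℤ +ˢ tail s) *ˢ s) n
    ≡⟨ *ˢ-distribʳ-+ˢ s ((ℤ.- + 2) · θ s +ˢ s +ˢ const 1ℤ) (tail s) n ⟩
  (((ℤ.- + 2) · θ s +ˢ s +ˢ const 1ℤ) *ˢ s) n ℤ.+ t
    ≡⟨ cong (ℤ._+ t) (*ˢ-distribʳ-+ˢ s ((ℤ.- + 2) · θ s +ˢ s) (const 1ℤ) n) ⟩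
  (((ℤ.- + 2) · θ s +ˢ s) *ˢ s) n ℤ.+ (const 1ℤ *ˢ s) n ℤ.+ t
    ≡⟨ cong₂ (λ a b → a ℤ.+ b ℤ.+ t)
         (trans (*ˢ-distribʳ-+ˢ s ((ℤ.- + 2) · θ s) s n)
                (cong (ℤ._+ p n) (·-*ˢ (ℤ.- + 2) (θ s) s n)))
         (const-*ˢ 1ℤ s n) ⟩
  ℤ.- + 2 ℤ.* q ℤ.+ p n ℤ.+ 1ℤ ℤ.* s n ℤ.+ t
    ≡⟨ regroup q (p n) (s n) t (s (suc n)) ⟩
  p n ℤ.+ p (suc n) ℤ.- + 2 ℤ.* q ℤ.+ s n ℤ.- s (suc n)
    ≡⟨ cong (λ r → p n ℤ.+ p (suc n) ℤ.- r ℤ.+ s n ℤ.- s (suc n)) (2·θ√*√ n) ⟩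
  p n ℤ.+ p (suc n) ℤ.- + n ℤ.* p n ℤ.+ s n ℤ.- s (suc n) ∎
  where
  open ≡-Reasoning
  s = √1-4x
  p = s *ˢ s
  q = (θ s *ˢ s) n
  t = (tail s *ˢ s) n

  regroup : ∀ q p s t s′ → ℤ.- + 2 ℤ.* q ℤ.+ p ℤ.+ 1ℤ ℤ.* s ℤ.+ t ≡
                           p ℤ.+ (1ℤ ℤ.* s′ ℤ.+ t) ℤ.- + 2 ℤ.* q ℤ.+ s ℤ.- s′
  regroup = ℤ-Ring.solve-∀

private
  denominator = const (+ 2) *ˢ 𝕩 *ˢ √1-4x
  numerator   = (const (+ 1) -ˢ const (+ 3) *ˢ 𝕩) -ˢ (const (+ 1) -ˢ 𝕩) *ˢ √1-4x

numerator-suc : ∀ n → numerator (suc n) ≡ ℤ.- (+ 3 ℤ.* 𝕩 (suc n)) ℤ.- √1-4x (suc n) ℤ.+ √1-4x n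
numerator-suc n = trans
  (cong₂ (λ a b → 0ℤ ℤ.- a ℤ.- (1ℤ ℤ.* √1-4x (suc n) ℤ.+ b)) (const-*ˢ (+ 3) 𝕩 (suc n))
    (trans (*ˢ-congʳ √1-4x tail-1-x n) (const-*ˢ -1ℤ √1-4x n)))
  (regroup (+ 3 ℤ.* 𝕩 (suc n)) (√1-4x (suc n)) (√1-4x n))
  where
  tail-1-x : tail (const (+ 1) -ˢ 𝕩) ≈ˢ const -1ℤ
  tail-1-x zero    = refl
  tail-1-x (suc _) = refl

  regroup : ∀ a s s′ → 0ℤ ℤ.- a ℤ.- (1ℤ ℤ.* s ℤ.+ -1ℤ ℤ.* s′) ≡ ℤ.- a ℤ.- s ℤ.+ s′
  regroup = ℤ-Ring.solve-∀

tail-denominator : tail denominator ≈ˢ + 2 · √1-4x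
tail-denominator n = trans (ℤ.+-identityˡ _)
  (trans (*ˢ-congʳ √1-4x tail-2x n) (const-*ˢ (+ 2) √1-4x n))
  where
  tail-2x : tail (const (+ 2) *ˢ 𝕩) ≈ˢ const (+ 2)
  tail-2x zero    = refl
  tail-2x (suc n) = const-*ˢ (+ 2) 𝕩 (2 + n)

edgeSeries-quotient : IsQuotient edgeSeries numerator denominator
edgeSeries-quotient = (λ eq → contradiction (eq 1) λ ()) , quotient
  where
  -- For p = 1 - 4x, p + (p - 1)/x - x p′ is the constant -3, which is the term -3x of the numerator
  -- divided by x.
  vanish : ∀ n → let p = √1-4x *ˢ √1-4x in
           p n ℤ.+ p (suc n) ℤ.- + n ℤ.* p n ≡ ℤ.- (+ 3 ℤ.* 𝕩 (suc n))
  vanish 0             = cong (λ z → 1ℤ ℤ.+ z ℤ.- 0ℤ) square-one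
  vanish 1             = cong₂ (λ y z → y ℤ.+ z ℤ.- 1ℤ ℤ.* y) square-one (square-≥2 0)
  vanish (suc (suc n)) = trans
    (cong₂ (λ y z → y ℤ.+ z ℤ.- + (2 + n) ℤ.* y) (square-≥2 n) (square-≥2 (suc n)))
    (cong (λ z → 0ℤ ℤ.- z) (ℤ.*-zeroʳ (+ (2 + n))))

  quotient : edgeSeries *ˢ denominator ≈ˢ numerator
  -- The factor x of the denominator makes both sides 0 at index 0; from index 1 on it acts as a
  -- shift.
  quotient zero    = trans (ℤ.+-identityʳ _) (ℤ.*-zeroʳ (edgeSeries 0))
  quotient (suc n) = begin
    (edgeSeries *ˢ denominator) (suc n)
      ≡⟨ *ˢ-comm edgeSeries denominator (suc n) ⟩
    0ℤ ℤ.+ (tail denominator *ˢ edgeSeries) n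
      ≡⟨ ℤ.+-identityˡ _ ⟩
    (tail denominator *ˢ edgeSeries) n
      ≡⟨ *ˢ-congʳ edgeSeries tail-denominator n ⟩
    (+ 2 · √1-4x *ˢ edgeSeries) n
      ≡⟨ ·-*ˢ (+ 2) √1-4x edgeSeries n ⟩
    + 2 ℤ.* (√1-4x *ˢ edgeSeries) n
      ≡⟨ cong (ℤ._*_ (+ 2)) (*ˢ-comm √1-4x edgeSeries n) ⟩
    + 2 ℤ.* (edgeSeries *ˢ √1-4x) n
      ≡⟨ 2·edgeSeries*√1-4x n ⟩
    p n ℤ.+ p (suc n) ℤ.- + n ℤ.* p n ℤ.+ √1-4x n ℤ.- √1-4x (suc n)
      ≡⟨ cong (λ z → z ℤ.+ √1-4x n ℤ.- √1-4x (suc n)) (vanish n) ⟩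
    ℤ.- (+ 3 ℤ.* 𝕩 (suc n)) ℤ.+ √1-4x n ℤ.- √1-4x (suc n)
      ≡⟨ swap (ℤ.- (+ 3 ℤ.* 𝕩 (suc n))) (√1-4x n) (√1-4x (suc n)) ⟩
    ℤ.- (+ 3 ℤ.* 𝕩 (suc n)) ℤ.- √1-4x (suc n) ℤ.+ √1-4x n
      ≡⟨ numerator-suc n ⟨
    numerator (suc n) ∎
    where
    open ≡-Reasoning
    p = √1-4x *ˢ √1-4x

    swap : ∀ a b c → a ℤ.+ b ℤ.- c ≡ a ℤ.- c ℤ.+ b
    swap = ℤ-Ring.solve-∀

-- Closed forms in ℚ and asymptotics

/-cross : ∀ a b d e .{{_ : NonZero d}} .{{_ : NonZero e}} → a ℤ.* + e ≡ b ℤ.* + d → a / d ≡ b / e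
/-cross a b (suc d) (suc e) eq = ℚ.fromℚᵘ-cong {mkℚᵘ a d} {mkℚᵘ b e} (*≡* eq)

toℚᵘ-/ : ∀ a d → toℚᵘ (a / suc d) ℚᵘ.≃ mkℚᵘ a d
toℚᵘ-/ a d = ℚ.toℚᵘ-fromℚᵘ (mkℚᵘ a d)

/-*-/ : ∀ a b d e → (a / suc d) ℚ.* (b / suc e) ≡ (a ℤ.* b) / (suc d * suc e)
/-*-/ a b d e = ℚ.toℚᵘ-injective (begin
  toℚᵘ ((a / suc d) ℚ.* (b / suc e))            ≈⟨ ℚ.toℚᵘ-homo-* (a / suc d) (b / suc e) ⟩
  toℚᵘ (a / suc d) ℚᵘ.* toℚᵘ (b / suc e)        ≈⟨ ℚᵘ.*-cong (toℚᵘ-/ a d) (toℚᵘ-/ b e) ⟩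
  mkℚᵘ (a ℤ.* b) (e + d * suc e)                ≈⟨ toℚᵘ-/ (a ℤ.* b) (e + d * suc e) ⟨
  toℚᵘ ((a ℤ.* b) / (suc d * suc e))            ∎)
  where open ℚᵘ.≃-Reasoning

ℓ-closed-rational : ∀ k → + ℓ (𝓓 (suc k)) / 1 ≡
  ½ ℚ.* (+ ((2 * suc k) C suc k) / 1) ℚ.* (+ k / (2 + k))
ℓ-closed-rational k = sym (trans (cong (ℚ._* (+ k / (2 + k))) (/-*-/ 1ℤ (+ c) 1 0))
  (trans (/-*-/ (1ℤ ℤ.* + c) (+ k) 1 (suc k))
    (/-cross (1ℤ ℤ.* + c ℤ.* + k) (+ l) (2 * (2 + k)) 1 (begin
      1ℤ ℤ.* + c ℤ.* + k ℤ.* 1ℤ          ≡⟨ swap (+ c) (+ k) ⟩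
      + k ℤ.* + c                        ≡⟨ ℤ.pos-* k c ⟨
      + (k * c)                          ≡⟨ cong +_ 2[n+1]ℓ ⟨
      + (l * (2 * (2 + k)))              ≡⟨ ℤ.pos-* l (2 * (2 + k)) ⟩
      + l ℤ.* + (2 * (2 + k))            ∎))))
  where
  open ≡-Reasoning
  c = (2 * suc k) C suc k
  l = ℓ (𝓓 (suc k))

  swap : ∀ c k → 1ℤ ℤ.* c ℤ.* k ℤ.* 1ℤ ≡ k ℤ.* c
  swap = ℤ-Ring.solve-∀

  2[n+1]ℓ : l * (2 * (2 + k)) ≡ k * c
  2[n+1]ℓ = begin
    l * (2 * (2 + k))               ≡⟨ ℕ.*-comm l (2 * (2 + k)) ⟩
    2 * (2 + k) * l                 ≡⟨ cong (2 * (2 + k) *_) (ℓ𝓓≡#coverings (suc k)) ⟩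
    2 * (2 + k) * edges (suc k)     ≡⟨ cong (_* edges (suc k)) (ℕ.*-comm 2 (2 + k)) ⟩
    (2 + k) * 2 * edges (suc k)     ≡⟨ ℕ.*-assoc (2 + k) 2 (edges (suc k)) ⟩
    (2 + k) * (2 * edges (suc k))   ≡⟨ cong ((2 + k) *_) (2*edges k) ⟩
    (2 + k) * (k * catalan (suc k)) ≡⟨ x∙yz≈y∙xz (2 + k) k (catalan (suc k)) ⟩
    k * ((2 + k) * catalan (suc k)) ≡⟨ cong (k *_) (catalan-closed (suc k)) ⟩
    k * ((suc k * 2) C suc k)       ≡⟨ cong (λ m → k * (m C suc k)) (ℕ.*-comm (suc k) 2) ⟩
    k * c                           ∎

hasseIndex-suc : ∀ k → hasseIndex (𝓓 (suc k)) {{𝓓-nonEmpty (suc k)}} ≡ + k / 2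
hasseIndex-suc k = /-cross (+ ℓ (𝓓 (suc k))) (+ k) ∣ 𝓓 (suc k) ∣ 2 {{𝓓-nonEmpty (suc k)}} (begin
  + ℓ (𝓓 (suc k)) ℤ.* + 2        ≡⟨ ℤ.pos-* (ℓ (𝓓 (suc k))) 2 ⟨
  + (ℓ (𝓓 (suc k)) * 2)          ≡⟨ cong +_ 2ℓ ⟩
  + (k * ∣ 𝓓 (suc k) ∣)          ≡⟨ ℤ.pos-* k ∣ 𝓓 (suc k) ∣ ⟩
  + k ℤ.* + ∣ 𝓓 (suc k) ∣        ∎)
  where
  open ≡-Reasoning

  2ℓ : ℓ (𝓓 (suc k)) * 2 ≡ k * ∣ 𝓓 (suc k) ∣
  2ℓ = begin
    ℓ (𝓓 (suc k)) * 2    ≡⟨ ℕ.*-comm (ℓ (𝓓 (suc k))) 2 ⟩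
    2 * ℓ (𝓓 (suc k))    ≡⟨ cong (2 *_) (ℓ𝓓≡#coverings (suc k)) ⟩
    2 * edges (suc k)     ≡⟨ 2*edges k ⟩
    k * catalan (suc k)   ≡⟨ cong (k *_) (∣𝓓∣≡#paths (suc k)) ⟨
    k * ∣ 𝓓 (suc k) ∣    ∎

ratio-suc : ∀ k .{{_ : ℚ.NonZero (+ suc k / 2)}} → (+ k / 2) ℚ.÷ (+ suc k / 2) ≡ + k / suc k
ratio-suc k = begin
  (+ k / 2) ℚ.* ℚ.1/ r                ≡⟨ cong (ℚ._* ℚ.1/ r) eq ⟨
  (+ k / suc k) ℚ.* r ℚ.* ℚ.1/ r      ≡⟨ ℚ.*-assoc (+ k / suc k) r (ℚ.1/ r) ⟩
  (+ k / suc k) ℚ.* (r ℚ.* ℚ.1/ r)    ≡⟨ cong (ℚ._*_ (+ k / suc k)) (ℚ.*-inverseʳ r) ⟩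
  (+ k / suc k) ℚ.* 1ℚ                ≡⟨ ℚ.*-identityʳ (+ k / suc k) ⟩
  + k / suc k                         ∎
  where
  open ≡-Reasoning
  r = + suc k / 2

  eq : (+ k / suc k) ℚ.* (+ suc k / 2) ≡ + k / 2
  eq = trans (/-*-/ (+ k) (+ suc k) k 1) (/-cross (+ k ℤ.* + suc k) (+ k) (suc k * 2) 2 (trans
    (ℤ.*-assoc (+ k) (+ suc k) (+ 2)) (cong (ℤ._*_ (+ k)) (sym (ℤ.pos-* (suc k) 2)))))

-- The distance is 1/(k + 1), while a positive fraction with denominator d + 1 is at least 1/(d +
-- 1).
∣ratio-1∣<ε : ∀ ε .{{_ : ℚ.Positive ε}} k → ℚ.ℚ.denominator-1 ε < k → ℚ.∣ + k / suc k ℚ.- 1ℚ ∣ ℚ.< ε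
∣ratio-1∣<ε ε@(mkℚ +[1+ p ] d _) k d<k = ℚ.toℚᵘ-cancel-< (begin-strict
  toℚᵘ ℚ.∣ + k / suc k ℚ.- 1ℚ ∣       ≃⟨ ℚ.toℚᵘ-homo-∣-∣ (+ k / suc k ℚ.- 1ℚ) ⟩
  ℚᵘ.∣ toℚᵘ (+ k / suc k ℚ.- 1ℚ) ∣    ≃⟨ ℚᵘ.∣-∣-cong toℚᵘ-difference ⟩
  ℚᵘ.∣ mkℚᵘ -1ℤ k ∣                   ≡⟨⟩
  mkℚᵘ 1ℤ k                           <⟨ *<* (ℤ.+<+ (s≤s d+0<[p+1][k+1]-1)) ⟩
  toℚᵘ ε                              ∎)
  where
  open ℚᵘ.≤-Reasoning

  d+0<[p+1][k+1]-1 : d + 0 < k + p * suc k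
  d+0<[p+1][k+1]-1 = subst (_< k + p * suc k) (sym (ℕ.+-identityʳ d)) (ℕ.m≤n⇒m≤n+o (p * suc k) d<k)

  difference : ∀ k → (k ℤ.* 1ℤ ℤ.+ -1ℤ ℤ.* (1ℤ ℤ.+ k)) ℤ.* (1ℤ ℤ.+ k) ≡ -1ℤ ℤ.* ((1ℤ ℤ.+ k) ℤ.* 1ℤ)
  difference = ℤ-Ring.solve-∀

  toℚᵘ-difference : toℚᵘ (+ k / suc k ℚ.- 1ℚ) ℚᵘ.≃ mkℚᵘ -1ℤ k
  toℚᵘ-difference = ℚᵘ.≃-trans (ℚ.toℚᵘ-homo-+ (+ k / suc k) (ℚ.- 1ℚ))
    (ℚᵘ.≃-trans (ℚᵘ.+-congˡ (ℚᵘ.- ℚᵘ.1ℚᵘ) (toℚᵘ-/ (+ k) k)) (*≡* (difference (+ k))))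

hasseIndex-∼ : (λ n → hasseIndex (𝓓 n) {{𝓓-nonEmpty n}}) ∼ (λ n → + n / 2)
-- For n = k + 1 the quotient is k/(k + 1), so n ≥ 2 + d gives the required d < k.
hasseIndex-∼ ε 0<ε = 2 + ℚ.ℚ.denominator-1 ε , λ where
  (suc k) (s≤s d<k) →
    let b≢0 = ℚ.pos⇒nonZero (+ suc k / 2) {{ℚ.normalize-pos (suc k) 2}} in
    b≢0 , subst (λ q → ℚ.∣ q ℚ.- 1ℚ ∣ ℚ.< ε)
      (sym (trans (cong (λ a → (a ℚ.÷ (+ suc k / 2)) {{b≢0}}) (hasseIndex-suc k))
                  (ratio-suc k {{b≢0}})))
      (∣ratio-1∣<ε ε {{ℚ.positive 0<ε}} k d<k)

mainTheorem3 :
    (∃[ √1-4x ] √1-4x IsSqrtOf (const (+ 1) -ˢ const (+ 4) *ˢ 𝕩)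
       × IsQuotient edgeSeries
           ((const (+ 1) -ˢ const (+ 3) *ˢ 𝕩) -ˢ (const (+ 1) -ˢ 𝕩) *ˢ √1-4x)
           (const (+ 2) *ˢ 𝕩 *ˢ √1-4x))
    × (∀ n → 2 ≤ n →
         (+ ℓ (𝓓 n) / 1 ≡ ½ ℚ.* (+ ((2 ℕ.* n) C n) / 1) ℚ.* ((+ n ℤ.- 1ℤ) / suc n))
       × (ℓ (𝓓 n) ≡ (2 ℕ.* n ∸ 1) C (n ∸ 2)))
    × (∀ n → 1 ≤ n → hasseIndex (𝓓 n) {{𝓓-nonEmpty n}} ≡ (+ n ℤ.- 1ℤ) / 2)
    × ((λ n → hasseIndex (𝓓 n) {{𝓓-nonEmpty n}}) ∼ (λ n → + n / 2))
mainTheorem3 =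
    (√1-4x , √1-4x-isSqrt , edgeSeries-quotient)
  , (λ { (suc (suc k)) (s≤s (s≤s _)) → ℓ-closed-rational (suc k)
       , trans (ℓ𝓓≡#coverings (2 + k))
           (trans (edges-closed k) (cong (λ m → (m ∸ 1) C k) (ℕ.*-comm (2 + k) 2))) })
  , (λ { (suc k) _ → hasseIndex-suc k })
  , hasseIndex-∼
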